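{- Let $T$ be any spanning tree of $G$ and let $\tau=\sum_{(i,j)\in T}\frac{r(i,j)}{R(C(i,j))}$ (which equals the total stretch $\mathrm{st}_T(G,\mathbf r)$ of $T$). Let $\epsilon>0$. After $K=\tau\ln(\frac{\tau}{\epsilon})$ iterations, the algorithm Dual KOSZ (run with the tree $T$) returns $\mathbf{x}^K\in\mathbb{R}^V$ and $\mathbf{f}^K\in\mathbb{R}^{\vec E}$ such that $$\mathbb{E}\|\mathbf{x}^*-\mathbf{x}^K\|_{\mathbf L}^2\le \frac{\epsilon}{\tau}\|\mathbf{x}^*\|_{\mathbf L}^2\quad\text{and}\quad \mathbb{E}[\mathcal{E}(\mathbf f^K)]\le(1+\epsilon)\mathcal{E}(\mathbf f^*),$$ where $\mathbf f^*$ is the minimum-energy $\mathbf b$-flow and $\mathbf x^*$ is any maximizer of $\mathcal B$.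
   Context: $G=(V,E)$ is a connected undirected graph with $n$ vertices and $m$ edges, resistances $r(e)>0$, and $\vec E$ an arbitrary fixed orientation of $E$; for $(i,j)\in\vec E$ set $f(j,i)=-f(i,j)$. A supply vector $\mathbf b\in\mathbb R^V$ satisfies $\sum_i b(i)=0$. A $\mathbf b$-flow is $\mathbf f\in\mathbb R^{\vec E}$ with $\sum_{j:(i,j)\in\vec E}f(i,j)-\sum_{j:(j,i)\in\vec E}f(j,i)=b(i)$ for all $i$. Energy: $\mathcal E(\mathbf f)=\frac12\sum_{e}r(e)f(e)^2$; $\mathbf f^*$ minimizes $\mathcal E$ over $\mathbf b$-flows. $\mathbf L=\sum_{ij\in E}\frac1{r(i,j)}(\mathbf e_i-\mathbf e_j)(\mathbf e_i-\mathbf e_j)^\top$, $\|\mathbf y\|_{\mathbf L}^2=\mathbf y^\top\mathbf L\mathbf y$, $\mathcal B(\mathbf x)=\mathbf b^\top\mathbf x-\frac12\mathbf x^\top\mathbf L\mathbf x$, and $\mathbf x^*$ maximizes $\mathcal B$ (equivalently $\mathbf L\mathbf x^*=\mathbf b$). Stretch: $\mathrm{st}_T(G,\mathbf r)=\sum_{(i,j)\in\vec E}\frac1{r(i,j)}\sum_{(k,l)\in P(i,j)}r(k,l)$, $P(i,j)$ the tree path. Root $T$ arbitrarily and direct tree edges toward the root; for a tree edge $(i,j)$, $C(i,j)$ is the vertex set of the component of $T-ij$ containing $i$. For $C\subset V$: $\delta(C)$ is the set of edges with exactly one endpoint in $C$, $R(C)=(\sum_{e\in\delta(C)}1/r(e))^{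 -1}$, $b(C)=\sum_{v\in C}b(v)$, and for potentials $\mathbf x$, $f_{\mathbf x}(C)=\sum_{ij\in E,\,i\in C,\,j\notin C}\frac{x(i)-x(j)}{r(i,j)}$. The tree-defined flow $\mathbf f_{T,\mathbf x}$ has $f_{T,\mathbf x}(i,j)=\frac{x(i)-x(j)}{r(i,j)}$ on non-tree edges, and on tree edges the unique values making it a $\mathbf b$-flow. Dual KOSZ: set $\mathbf x^0=0$; in each iteration $t$, sample a tree edge $(i,j)$ with probability $P_{ij}=\frac1\tau\cdot\frac{r(i,j)}{R(C(i,j))}$ independently, let $C=C(i,j)$, $\Delta^t=(b(C)-f_{\mathbf x^t}(C))R(C)$, and set $x^{t+1}(v)=x^t(v)+\Delta^t$ for $v\in C$, $x^{t+1}(v)=x^t(v)$ otherwise. After $K$ iterations output $\mathbf x^K$ and $\mathbf f^K=\mathbf f_{T,\mathbf x^K}$. -}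

module Defs where

open import Algebra.Bundles using (CommutativeRing; Semiring)
open import Data.Bool.Base using (if_then_else_; _xor_)
open import Data.Fin.Base using (Fin)
open import Data.Fin.Properties using (_≟_)
open import Data.Fin.Subset using (Subset; _∈_; _∉_) renaming (_-_ to _∖_)
open import Data.Fin.Subset.Properties using (_∈?_)
open import Data.List.Base using (List; []; _∷_; length; drop; map; foldr; filter; allFin)
open import Data.List.Membership.Propositional using () renaming (_∈_ to _∈ₗ_)
open import Data.List.Membership.Propositional.Properties using (∈-allFin; ∈-filter⁺; ∈-filter⁻)
import Data.List.Membership.DecPropositional as DecMembership
open import Data.List.Relation.Unary.All using ([]; _∷_)
open import Data.List.Relation.Unary.All.Properties using (¬Any⇒All¬)
open import Data.List.Relation.Unary.AllPairs using ([]; _∷_)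
open import Data.List.Relation.Unary.Any using (here; there)
open import Data.List.Relation.Unary.Unique.Propositional using (Unique)
open import Data.Nat.Base as ℕ using (ℕ; zero; suc)
open import Data.Product.Base using (_×_; _,_; proj₂; ∃; ∃-syntax)
open import Data.Sum.Base using (_⊎_; inj₁; inj₂)
open import Data.Vec.Base using (Vec; []; _∷_; lookup; tabulate)
open import Function.Base using (_∘_)
open import Level using (0ℓ)
open import Relation.Binary.Core using (Rel)
open import Relation.Binary.PropositionalEquality using (_≡_; _≢_; refl; sym; trans)
open import Relation.Binary.Structures using (IsDecTotalOrder)
import Relation.Binary.Construct.NonStrictToStrict as Strict
open import Relation.Nullary using (¬_; Dec; yes; no; does)
open import Relation.Nullary.Decidable using (map′; _×-dec_; _⊎-dec_)
open import Relation.Unary using (Pred)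

-- The real numbers, axiomatised up to isomorphism: a Dedekind-complete
-- ordered field.  The order is decidable, as it is classically.
record CompleteOrderedField : Set₁ where
  infix  8 _⁻¹
  infixl 7 _/_
  infix  4 _≤_ _<_
  field
    commutativeRing : CommutativeRing 0ℓ 0ℓ

  open CommutativeRing commutativeRing public
    using (_≈_; _+_; _*_; 0#; 1#; semiring)
    renaming (Carrier to ℝ; -_ to infix 8 -_; _-_ to infixl 6 _-_)

  field
    -- Total, with an unspecified value at 0.
    _⁻¹             : ℝ → ℝ
    _≤_             : Rel ℝ 0ℓ
    isDecTotalOrder : IsDecTotalOrder _≈_ _≤_
    0≉1             : ¬ (0# ≈ 1#)
    ⁻¹-inverseʳ     : ∀ {x} → ¬ (x ≈ 0#) → x * x ⁻¹ ≈ 1#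
    +-monoˡ-≤       : ∀ z {x y} → x ≤ y → x + z ≤ y + z
    *-nonneg        : ∀ {x y} → 0# ≤ x → 0# ≤ y → 0# ≤ x * y

  _<_ : Rel ℝ 0ℓ
  _<_ = Strict._<_ _≈_ _≤_

  IsUpperBound : Pred ℝ 0ℓ → Pred ℝ 0ℓ
  IsUpperBound S u = ∀ x → S x → x ≤ u

  field
    complete : (S : Pred ℝ 0ℓ) → ∃ S → ∃ (IsUpperBound S) →
               ∃[ s ] (IsUpperBound S s × (∀ u → IsUpperBound S u → s ≤ u))

  _/_ : ℝ → ℝ → ℝ
  x / y = x * y ⁻¹

  open import Algebra.Definitions.RawSemiring
    (Semiring.rawSemiring semiring) public
    using (sum; _^_)
    renaming (_×_ to _·_)

  fromℕ : ℕ → ℝ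
  fromℕ k = k · 1#

  ½ : ℝ
  ½ = (1# + 1#) ⁻¹

  _⟶_ : (ℕ → ℝ) → ℝ → Set
  s ⟶ y = ∀ δ → 0# < δ →
    ∃[ N ] (∀ k → N ℕ.≤ k → (- δ < s k - y) × (s k - y < δ))

  -- IsExp x y means y = exp x = lim (1 + x/k)^k, with k = 1, 2, 3, …
  IsExp : ℝ → ℝ → Set
  IsExp x y = (λ k → (1# + x / fromℕ (suc k)) ^ suc k) ⟶ y

  -- IsLn y x means x = ln y.
  IsLn : ℝ → ℝ → Set
  IsLn y x = IsExp x y

-- A finite simple graph on Fin n with edges Fin m; src and tgt give the
-- fixed orientation.
record Graph (n m : ℕ) : Set where
  field
    src tgt : Fin m → Fin n

  Joins : Fin m → Fin n → Fin n → Set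
  Joins e u v = (src e ≡ u × tgt e ≡ v) ⊎ (src e ≡ v × tgt e ≡ u)

  field
    loopless : ∀ e → src e ≢ tgt e
    simple   : ∀ {e e′} → Joins e (src e′) (tgt e′) → e ≡ e′

module _ {n m : ℕ} (G : Graph n m) where
  open Graph G

  -- Walks from u to v in the subgraph with edge set F; edges may be
  -- traversed in either direction.
  data Walk (F : Subset m) : Fin n → Fin n → Set where
    stop : ∀ {u} → Walk F u u
    step : ∀ {u v w} e → e ∈ F → Joins e u v → Walk F v w → Walk F u w

module _ {n m : ℕ} {G : Graph n m} {F : Subset m} where

  vertices : ∀ {u v} → Walk G F u v → List (Fin n)
  vertices (stop {u})           = u ∷ []
  vertices (step {u} e e∈F j w) = u ∷ vertices w

  edges : ∀ {u v} → Walk G F u v → List (Fin m)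
  edges stop             = []
  edges (step e e∈F j w) = e ∷ edges w

module _ {n m : ℕ} (G : Graph n m) where
  open Graph G

  record Path (F : Subset m) (u v : Fin n) : Set where
    constructor mkPath
    field
      walk     : Walk G F u v
      distinct : Unique (vertices walk)

  -- The first vertex of a closed walk recurs as its last.
  record Cycle (F : Subset m) : Set where
    field
      base     : Fin n
      walk     : Walk G F base base
      long     : 3 ℕ.≤ length (edges walk)
      distinct : Unique (drop 1 (vertices walk))

  Connected : Subset m → Set
  Connected F = ∀ u v → Walk G F u v

  record SpanningTree : Set where
    field
      T         : Subset m
      connected : Connected T
      acyclic   : ¬ Cycle T

-- Loop erasure.
module _ {n m : ℕ} {G : Graph n m} {F : Subset m} where
  private
    module V = DecMembership (_≟_ {n})

    from : ∀ {u v x} (w : Walk G F u v) → Unique (vertices w) →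
           x ∈ₗ vertices w → Path G F x v
    from stop           d       (here refl) = mkPath stop d
    from (step e p j w) d       (here refl) = mkPath (step e p j w) d
    from (step e p j w) (_ ∷ d) (there x∈w) = from w d x∈w

  erase : ∀ {u v} → Walk G F u v → Path G F u v
  erase stop = mkPath stop ([] ∷ [])
  erase (step {u} e p j w) with erase w
  ... | mkPath w′ d with u V.∈? vertices w′
  ...   | yes u∈w′ = from w′ d u∈w′
  ...   | no  u∉w′ = mkPath (step e p j w′) (¬Any⇒All¬ _ u∉w′ ∷ d)

-- Existence of a walk is decided by adding one edge at a time.
module _ {n m : ℕ} (G : Graph n m) where
  open Graph G

  private
    Conn : List (Fin m) → Fin n → Fin n → Set
    Conn []       u v = u ≡ v
    Conn (e ∷ es) u v = Conn es u v
      ⊎ (Conn es u (src e) × Conn es (tgt e) v)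
      ⊎ (Conn es u (tgt e) × Conn es (src e) v)

    conn? : ∀ es u v → Dec (Conn es u v)
    conn? []       u v = u ≟ v
    conn? (e ∷ es) u v = conn? es u v
      ⊎-dec (conn? es u (src e) ×-dec conn? es (tgt e) v)
      ⊎-dec (conn? es u (tgt e) ×-dec conn? es (src e) v)

    conn-refl : ∀ es {u} → Conn es u u
    conn-refl []       = refl
    conn-refl (e ∷ es) = inj₁ (conn-refl es)

    conn-sym : ∀ es {u v} → Conn es u v → Conn es v u
    conn-sym []       p                    = sym p
    conn-sym (e ∷ es) (inj₁ p)             = inj₁ (conn-sym es p)
    conn-sym (e ∷ es) (inj₂ (inj₁ (p , q))) = inj₂ (inj₂ (conn-sym es q , conn-sym es p))
    conn-sym (e ∷ es) (inj₂ (inj₂ (p , q))) = inj₂ (inj₁ (conn-sym es q , conn-sym es p))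

    conn-trans : ∀ es {u v w} → Conn es u v → Conn es v w → Conn es u w
    conn-trans [] p q = trans p q
    conn-trans (e ∷ es) (inj₁ p) (inj₁ q) = inj₁ (conn-trans es p q)
    conn-trans (e ∷ es) (inj₁ p) (inj₂ (inj₁ (q , r))) = inj₂ (inj₁ (conn-trans es p q , r))
    conn-trans (e ∷ es) (inj₁ p) (inj₂ (inj₂ (q , r))) = inj₂ (inj₂ (conn-trans es p q , r))
    conn-trans (e ∷ es) (inj₂ (inj₁ (p , q))) (inj₁ r) = inj₂ (inj₁ (p , conn-trans es q r))
    conn-trans (e ∷ es) (inj₂ (inj₂ (p , q))) (inj₁ r) = inj₂ (inj₂ (p , conn-trans es q r))
    conn-trans (e ∷ es) (inj₂ (inj₁ (p , q))) (inj₂ (inj₁ (r , s))) = inj₂ (inj₁ (p , s))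
    conn-trans (e ∷ es) (inj₂ (inj₁ (p , q))) (inj₂ (inj₂ (r , s))) = inj₁ (conn-trans es p s)
    conn-trans (e ∷ es) (inj₂ (inj₂ (p , q))) (inj₂ (inj₁ (r , s))) = inj₁ (conn-trans es p s)
    conn-trans (e ∷ es) (inj₂ (inj₂ (p , q))) (inj₂ (inj₂ (r , s))) = inj₂ (inj₂ (p , s))

    conn-edge : ∀ {es e u v} → e ∈ₗ es → Joins e u v → Conn es u v
    conn-edge {e ∷ es} (here refl) (inj₁ (refl , refl)) = inj₂ (inj₁ (conn-refl es , conn-refl es))
    conn-edge {e ∷ es} (here refl) (inj₂ (refl , refl)) = inj₂ (inj₂ (conn-refl es , conn-refl es))
    conn-edge {e ∷ es} (there e∈)  j                    = inj₁ (conn-edge e∈ j)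

    _++ʷ_ : ∀ {F u v w} → Walk G F u v → Walk G F v w → Walk G F u w
    stop         ++ʷ w′ = w′
    step e p j w ++ʷ w′ = step e p j (w ++ʷ w′)

    conn⇒walk : ∀ {F} es → (∀ {e} → e ∈ₗ es → e ∈ F) →
                ∀ {u v} → Conn es u v → Walk G F u v
    conn⇒walk []       s refl     = stop
    conn⇒walk (e ∷ es) s (inj₁ p) = conn⇒walk es (s ∘ there) p
    conn⇒walk (e ∷ es) s (inj₂ (inj₁ (p , q))) =
      conn⇒walk es (s ∘ there) p ++ʷ
      step e (s (here refl)) (inj₁ (refl , refl)) (conn⇒walk es (s ∘ there) q)
    conn⇒walk (e ∷ es) s (inj₂ (inj₂ (p , q))) =
      conn⇒walk es (s ∘ there) p ++ʷ
      step e (s (here refl)) (inj₂ (refl , refl)) (conn⇒walk es (s ∘ there) q)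

    walk⇒conn : ∀ {F} es → (∀ {e} → e ∈ F → e ∈ₗ es) →
                ∀ {u v} → Walk G F u v → Conn es u v
    walk⇒conn es c stop           = conn-refl es
    walk⇒conn es c (step e p j w) = conn-trans es (conn-edge (c p) j) (walk⇒conn es c w)

  walk? : ∀ F u v → Dec (Walk G F u v)
  walk? F u v = map′
    (conn⇒walk es (proj₂ ∘ ∈-filter⁻ (_∈? F) {xs = allFin m}))
    (walk⇒conn es (∈-filter⁺ (_∈? F) (∈-allFin _)))
    (conn? es u v)
    where es = filter (_∈? F) (allFin m)

  component : Subset m → Fin n → Subset n
  component F u = tabulate (λ v → does (walk? F u v))

module RootedTree {n m : ℕ} {G : Graph n m} (tree : SpanningTree G) (root : Fin n) where
  open Graph G
  open SpanningTree tree
  private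
    module E = DecMembership (_≟_ {m})

  -- P(i,j); since T is acyclic, the only path from i to j in T.
  treePath : ∀ i j → Path G T i j
  treePath i j = erase (connected i j)

  pathEdges : Fin n → Fin n → List (Fin m)
  pathEdges i j = edges (Path.walk (treePath i j))

  -- The endpoint i of a tree edge e = ij directed as (i,j) toward the
  -- root: the one whose path to the root traverses e.
  tail : Fin m → Fin n
  tail e = if does (e E.∈? pathEdges (src e) root) then src e else tgt e

  C : Fin m → Subset n
  C e = component G (T ∖ e) (tail e)

module Network (𝓡 : CompleteOrderedField) {n m : ℕ} (G : Graph n m)
               (r : Fin m → CompleteOrderedField.ℝ 𝓡)
               (b : Fin n → CompleteOrderedField.ℝ 𝓡) where
  open CompleteOrderedField 𝓡
  open Graph G

  Potential Flow : Set
  Potential = Fin n → ℝ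
  Flow      = Fin m → ℝ

  sumOver : ∀ {k} → Subset k → (Fin k → ℝ) → ℝ
  sumOver S f = sum (λ i → if lookup S i then f i else 0#)

  [_≡?_] : Fin n → Fin n → ℝ
  [ i ≡? j ] = if does (i ≟ j) then 1# else 0#

  divergence : Flow → Fin n → ℝ
  divergence f i = sum (λ e → [ src e ≡? i ] * f e) - sum (λ e → [ tgt e ≡? i ] * f e)

  IsFlow : Flow → Set
  IsFlow f = ∀ i → divergence f i ≈ b i

  energy : Flow → ℝ
  energy f = ½ * sum (λ e → r e * (f e * f e))

  IsMinimumEnergyFlow : Flow → Set
  IsMinimumEnergyFlow f = IsFlow f × (∀ g → IsFlow g → energy f ≤ energy g)

  L : Fin n → Fin n → ℝ
  L i j = sum (λ e → r e ⁻¹ * (χ e i * χ e j))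
    where
    χ : Fin m → Fin n → ℝ
    χ e i = [ src e ≡? i ] - [ tgt e ≡? i ]

  ‖_‖²ᴸ : Potential → ℝ
  ‖ y ‖²ᴸ = sum (λ i → sum (λ j → y i * L i j * y j))

  𝓑 : Potential → ℝ
  𝓑 x = sum (λ i → b i * x i) - ½ * ‖ x ‖²ᴸ

  IsMaximizer : Potential → Set
  IsMaximizer x = ∀ y → 𝓑 y ≤ 𝓑 x

  ohm : Potential → Flow
  ohm x e = (x (src e) - x (tgt e)) / r e

  δ : Subset n → Subset m
  δ S = tabulate (λ e → lookup S (src e) xor lookup S (tgt e))

  R : Subset n → ℝ
  R S = sumOver (δ S) (λ e → r e ⁻¹) ⁻¹

  supply : Subset n → ℝ
  supply S = sumOver S b

  -- f_x(S): each edge of δ(S) is read in the direction leaving S.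
  cutFlow : Potential → Subset n → ℝ
  cutFlow x S = sumOver (δ S) (λ e → if lookup S (src e) then ohm x e else - ohm x e)

  module DualKOSZ (tree : SpanningTree G) (root : Fin n) where
    open SpanningTree tree
    open RootedTree tree root

    τ : ℝ
    τ = sumOver T (λ e → r e / R (C e))

    stretch : ℝ
    stretch = sum (λ e → r e ⁻¹ * foldr _+_ 0# (map r (pathEdges (src e) (tgt e))))

    IsTreeDefinedFlow : Potential → Flow → Set
    IsTreeDefinedFlow x f = (∀ e → e ∉ T → f e ≈ ohm x e) × IsFlow f

    probability : Fin m → ℝ
    probability e = τ ⁻¹ * (r e / R (C e))

    update : Potential → Fin m → Potential
    update x e v = if lookup (C e) v then x v + Δ else x v
      where
      Δ : ℝ
      Δ = (supply (C e) - cutFlow x (C e)) * R (C e)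

    run : ∀ {K} → Potential → Vec (Fin m) K → Potential
    run x []      = x
    run x (e ∷ ω) = run (update x e) ω

    -- x^K as a function of the sequence ω of sampled edges.
    xᴷ : ∀ {K} → Vec (Fin m) K → Potential
    xᴷ = run (λ _ → 0#)

    -- Expectation over K independent samples, i.e. under the product measure.
    𝔼 : ∀ K → (Vec (Fin m) K → ℝ) → ℝ
    𝔼 zero    φ = φ []
    𝔼 (suc K) φ = sumOver T (λ e → probability e * 𝔼 K (λ ω → φ (e ∷ ω)))

{-# OPTIONS --safe #-}

-- In the bilinear form ⟪x, y⟫ of L, a cut C has flow f_x(C) = ⟪1_C, x⟫ and 1/R(C) = ⟪1_C, 1_C⟫,
-- and maximality of x* means b∙z = ⟪z, x*⟫ for all z.  Hence an update along C(e) projects the error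
-- y = x* - x: it lowers ⟪y, y⟫ by R(C) ⟪1_C, y⟫², in expectation by (1/τ) Σ_{e∈T} r(e) ⟪1_{C(e)}, y⟫².
-- The values ±⟪1_{C(e)}, y⟫ on T form a flow with the same divergence as the electrical flow of y, so
-- the sum is at least ⟪y, y⟫, and each step contracts the expected error by 1 - 1/τ.
-- The tree-defined flow differs from the electrical flow of x exactly by these values on T, and
-- R(C) ⟪1_C, y⟫² ≤ ⟪y, y⟫ by Cauchy-Schwarz, so its duality gap is at most τ⟪y, y⟫/2.
module Submission where

open import Defs
open import Algebra.Bundles using (CommutativeRing; Semiring)
import Algebra.Definitions.RawSemiring as RawSemiringDefinitions
import Algebra.Properties.CommutativeSemiring.Exp as CommutativeSemiringExp
import Algebra.Properties.Ring as RingProperties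
import Algebra.Properties.Semiring.Exp as SemiringExp
import Algebra.Properties.Semiring.Mult as SemiringMult
import Algebra.Properties.Semiring.Mult.TCOptimised as SemiringMult′
import Algebra.Properties.Semiring.Sum as SemiringSum
import Algebra.Solver.Ring as RingSolver
open import Algebra.Solver.Ring.AlmostCommutativeRing
  using (fromCommutativeRing; _-Raw-AlmostCommutative⟶_)
open import Data.Bool.Base using (Bool; true; false; if_then_else_; _xor_)
open import Data.Bool.Properties using (⇔→≡; ¬-not)
open import Data.Fin.Base using (Fin; zero; suc)
import Data.Fin.Properties as Fin
open import Data.Fin.Subset using (Subset; ⊤; _∈_; _∉_; _⊆_) renaming (_-_ to _∖_)
open import Data.Fin.Subset.Properties using (_∈?_; p─q⊆p; x∈p∧x≢y⇒x∈p-y)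
open import Data.Integer.Base as ℤ using (ℤ; +_; -[1+_]; _⊖_; _◃_)
import Data.Integer.Properties as ℤ
open import Data.List.Base using (_∷_; length; foldr; map)
import Data.List.Membership.DecPropositional as DecMembership
open import Data.List.Membership.Propositional using () renaming (_∉_ to _∉ₗ_; _∈_ to _∈ₗ_)
open import Data.List.Relation.Unary.All.Properties using (All¬⇒¬Any)
open import Data.List.Relation.Unary.AllPairs using (_∷_)
open import Data.List.Relation.Unary.Any using (here; there)
open import Data.List.Relation.Unary.Unique.Propositional using (Unique)
open import Data.Maybe.Base using (Maybe; just; nothing)
open import Data.Nat.Base as ℕ using (ℕ; zero; suc; s≤s; z≤n)
import Data.Nat.Properties as ℕ
open import Data.Product.Base using (_×_; _,_; proj₁; proj₂; ∃-syntax)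
import Data.Sign.Base as Sign
open import Data.Sum.Base using (_⊎_; inj₁; inj₂; swap)
open import Data.Vec.Base using (Vec; []; _∷_; lookup) renaming (there to thereᵥ)
open import Data.Vec.Properties using (lookup∘tabulate; lookup⇒[]=; []=⇒lookup)
open import Function.Base using (_∘_)
open import Function.Bundles using (mk⇔)
open import Relation.Binary.Bundles using (DecTotalOrder)
open import Relation.Binary.PropositionalEquality.Core as ≡ using (_≡_; _≢_)
open import Relation.Nullary using (¬_; Dec; yes; no; does; contradiction)
open import Relation.Nullary.Decidable using (dec-true; dec-false; decidable-stable)

-- Ordered fields

-- Three obstacles shape the proof. The exponential exists only as the limit of (1 + x/k)^k and ln
-- only as the inverse relation, so no law of exp can be quoted to pass from (1 - 1/τ)^K to ε/τ.
-- Instead (1 - s)^K exp(ℓ) ≤ 1 for ℓ ≤ K s is read off a subsequence on which the factors group as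
-- ((1 - s)(1 + s/q)^q)^K, with Bernoulli's inequality for the base. As τ ln(τ/ε) need not be an
-- integer, K is any natural number at or above it. Powers of 1 - 1/τ can be compared only if this
-- number is nonnegative. Every tree edge lies in its own cut, so r/R ≥ 1 and τ ≥ 1 once T has an
-- edge; the edgeless graph is a separate case. The sampling weights are forced: a step along C(e)
-- lowers the error by a multiple of R(C(e)), and the weight r/R turns this into r, the weight of a
-- tree energy, with normalising constant τ. The same weights occur in the duality gap, whose factor
-- τ is why the distance is bounded with ε/τ and not ε.

module OrderedField (𝓡 : CompleteOrderedField) where
  open CompleteOrderedField 𝓡
  open CommutativeRing commutativeRing public using
    ( refl; sym; trans; reflexive; setoid; ring; +-cong; +-congˡ; +-congʳ; +-comm
    ; *-cong; *-congˡ; *-congʳ; *-comm; -‿cong; +-identityˡ; +-identityʳ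
    ; *-identityˡ; *-identityʳ; zeroˡ; zeroʳ; -‿inverseʳ; +-assoc; *-assoc)
  open RingProperties ring using (-‿distribˡ-*; -‿distribʳ-*; -‿+-comm; -0#≈0#; -‿involutive)
  open SemiringMult′ semiring using (×-homo-+; ×1-homo-*; 1+×)

  decTotalOrder : DecTotalOrder _ _ _
  decTotalOrder = record { isDecTotalOrder = isDecTotalOrder }

  open DecTotalOrder decTotalOrder public using (_≟_; _≤?_; total; poset)
    renaming (refl to ≤-refl; trans to ≤-trans; antisym to ≤-antisym; reflexive to ≤-reflexive)
  open import Relation.Binary.Reasoning.PartialOrder poset public

  open RawSemiringDefinitions (Semiring.rawSemiring semiring) using (_×′_)

  -- The ring solver cancels terms by evaluating coefficient equality. Decidability of equality on
  -- `ℝ` is an axiom that never reduces, while equality on `ℤ` does, so the numerals come from `ℤ`.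
  module IntegerCoefficients where
    -- The numeral 1 must denote 1# itself, not 1# + 0#.
    fromℕ′ : ℕ → ℝ
    fromℕ′ n = n ×′ 1#

    ⟦_⟧ : ℤ → ℝ
    ⟦ + n      ⟧ = fromℕ′ n
    ⟦ -[1+ n ] ⟧ = - fromℕ′ (suc n)

    private
      cancel-1 : ∀ x y → x - y ≈ (1# + x) - (1# + y)
      cancel-1 x y = begin-equality
        x - y                    ≈⟨ +-identityˡ _ ⟨
        0# + (x - y)             ≈⟨ +-congʳ (-‿inverseʳ 1#) ⟨
        (1# - 1#) + (x - y)      ≈⟨ +-assoc _ _ _ ⟩
        1# + (- 1# + (x - y))    ≈⟨ +-congˡ (trans (sym (+-assoc _ _ _)) (trans (+-congʳ (+-comm _ _)) (+-assoc _ _ _))) ⟩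
        1# + (x + (- 1# - y))    ≈⟨ +-assoc _ _ _ ⟨
        (1# + x) + (- 1# - y)    ≈⟨ +-congˡ (-‿+-comm 1# y) ⟩
        (1# + x) - (1# + y)      ∎

    ⊖-homo : ∀ m n → ⟦ m ⊖ n ⟧ ≈ fromℕ′ m - fromℕ′ n
    ⊖-homo zero    zero    = sym (-‿inverseʳ 0#)
    ⊖-homo zero    (suc n) = sym (+-identityˡ _)
    ⊖-homo (suc m) zero    = sym (trans (+-congˡ -0#≈0#) (+-identityʳ _))
    ⊖-homo (suc m) (suc n) = trans (reflexive (≡.cong ⟦_⟧ (ℤ.[1+m]⊖[1+n]≡m⊖n m n)))
                               (trans (⊖-homo m n) (trans (cancel-1 _ _)
                                 (sym (+-cong (1+× m 1#) (-‿cong (1+× n 1#))))))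

    +-homo : ∀ i j → ⟦ i ℤ.+ j ⟧ ≈ ⟦ i ⟧ + ⟦ j ⟧
    +-homo (+ m)      (+ n)      = ×-homo-+ 1# m n
    +-homo (+ m)      -[1+ n ]   = ⊖-homo m (suc n)
    +-homo -[1+ m ]   (+ n)      = trans (⊖-homo n (suc m)) (+-comm _ _)
    +-homo -[1+ m ]   -[1+ n ]   = trans
      (-‿cong (trans (reflexive (≡.cong fromℕ′ (≡.sym (ℕ.+-suc (suc m) n)))) (×-homo-+ 1# (suc m) (suc n))))
      (sym (-‿+-comm _ _))

    ◃-homo : ∀ n → ⟦ Sign.- ◃ n ⟧ ≈ - fromℕ′ n
    ◃-homo zero    = sym -0#≈0#
    ◃-homo (suc n) = refl

    *-homo : ∀ i j → ⟦ i ℤ.* j ⟧ ≈ ⟦ i ⟧ * ⟦ j ⟧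
    *-homo (+ m)    (+ n)    = trans (reflexive (≡.cong ⟦_⟧ (ℤ.+◃n≡+n (m ℕ.* n)))) (×1-homo-* m n)
    *-homo (+ m)    -[1+ n ] = trans (◃-homo (m ℕ.* suc n)) (trans (-‿cong (×1-homo-* m (suc n))) (-‿distribʳ-* _ _))
    *-homo -[1+ m ] (+ n)    = trans (◃-homo (suc m ℕ.* n)) (trans (-‿cong (×1-homo-* (suc m) n)) (-‿distribˡ-* _ _))
    *-homo -[1+ m ] -[1+ n ] = trans (×1-homo-* (suc m) (suc n))
      (trans (sym (-‿involutive _)) (trans (-‿cong (-‿distribˡ-* _ _)) (-‿distribʳ-* _ _)))

    -‿homo : ∀ i → ⟦ ℤ.- i ⟧ ≈ - ⟦ i ⟧
    -‿homo (+ zero)   = sym -0#≈0#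
    -‿homo (+ suc n)  = refl
    -‿homo -[1+ n ]   = sym (-‿involutive _)

    morphism : ℤ.+-*-rawRing -Raw-AlmostCommutative⟶ fromCommutativeRing commutativeRing
    morphism = record
      { ⟦_⟧    = ⟦_⟧
      ; +-homo = +-homo
      ; *-homo = *-homo
      ; -‿homo = -‿homo
      ; 0-homo = refl
      ; 1-homo = refl
      }

    _coeff≟_ : ∀ i j → Maybe (⟦ i ⟧ ≈ ⟦ j ⟧)
    i coeff≟ j with i ℤ.≟ j
    ... | yes i≡j = just (reflexive (≡.cong ⟦_⟧ i≡j))
    ... | no  _   = nothing

  open RingSolver ℤ.+-*-rawRing (fromCommutativeRing commutativeRing)
    IntegerCoefficients.morphism IntegerCoefficients._coeff≟_ public
    using (solve; _:=_; _:+_; _:*_; _:-_; :-_; con)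


  -- Order, inverses and numerals

  0≤y-x⇒x≤y : ∀ {x y} → 0# ≤ y - x → x ≤ y
  0≤y-x⇒x≤y {x} {y} 0≤y-x = begin
    x            ≈⟨ +-identityˡ x ⟨
    0# + x       ≤⟨ +-monoˡ-≤ x 0≤y-x ⟩
    y - x + x    ≈⟨ solve 2 (λ x y → y :- x :+ x := y) refl x y ⟩
    y            ∎

  x≤y⇒0≤y-x : ∀ {x y} → x ≤ y → 0# ≤ y - x
  x≤y⇒0≤y-x {x} x≤y = ≤-trans (≤-reflexive (sym (-‿inverseʳ x))) (+-monoˡ-≤ (- x) x≤y)

  +-mono-≤ : ∀ {x y u v} → x ≤ y → u ≤ v → x + u ≤ y + v
  +-mono-≤ {x} {y} {u} {v} x≤y u≤v = begin
    x + u   ≤⟨ +-monoˡ-≤ u x≤y ⟩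
    y + u   ≈⟨ +-comm y u ⟩
    u + y   ≤⟨ +-monoˡ-≤ y u≤v ⟩
    v + y   ≈⟨ +-comm v y ⟩
    y + v   ∎

  +-monoʳ-≤ : ∀ z {x y} → x ≤ y → z + x ≤ z + y
  +-monoʳ-≤ z = +-mono-≤ ≤-refl

  +-nonneg : ∀ {x y} → 0# ≤ x → 0# ≤ y → 0# ≤ x + y
  +-nonneg 0≤x 0≤y = ≤-trans (≤-reflexive (sym (+-identityˡ 0#))) (+-mono-≤ 0≤x 0≤y)

  *-monoʳ-≤ : ∀ {z x y} → 0# ≤ z → x ≤ y → z * x ≤ z * y
  *-monoʳ-≤ {z} {x} {y} 0≤z x≤y = 0≤y-x⇒x≤y (≤-trans (*-nonneg 0≤z (x≤y⇒0≤y-x x≤y))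
    (≤-reflexive (solve 3 (λ z x y → z :* (y :- x) := z :* y :- z :* x) refl z x y)))

  *-mono-≤ : ∀ {x y u v} → 0# ≤ y → 0# ≤ u → x ≤ y → u ≤ v → x * u ≤ y * v
  *-mono-≤ {x} {y} {u} {v} 0≤y 0≤u x≤y u≤v = begin
    x * u   ≈⟨ *-comm x u ⟩
    u * x   ≤⟨ *-monoʳ-≤ 0≤u x≤y ⟩
    u * y   ≈⟨ *-comm u y ⟩
    y * u   ≤⟨ *-monoʳ-≤ 0≤y u≤v ⟩
    y * v   ∎

  -‿nonneg : ∀ {x} → x ≤ 0# → 0# ≤ - x
  -‿nonneg x≤0 = ≤-trans (x≤y⇒0≤y-x x≤0) (≤-reflexive (+-identityˡ _))

  square-nonneg : ∀ x → 0# ≤ x * x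
  square-nonneg x with total 0# x
  ... | inj₁ 0≤x = *-nonneg 0≤x 0≤x
  ... | inj₂ x≤0 = ≤-trans (*-nonneg (-‿nonneg x≤0) (-‿nonneg x≤0))
                     (≤-reflexive (solve 1 (λ x → (:- x) :* (:- x) := x :* x) refl x))

  0≤1 : 0# ≤ 1#
  0≤1 = ≤-trans (square-nonneg 1#) (≤-reflexive (*-identityˡ 1#))

  0<1 : 0# < 1#
  0<1 = 0≤1 , 0≉1

  ≰⇒≥ : ∀ {x y} → ¬ (x ≤ y) → y ≤ x
  ≰⇒≥ {x} {y} x≰y with total x y
  ... | inj₁ x≤y = contradiction x≤y x≰y
  ... | inj₂ y≤x = y≤x

  <⇒≱ : ∀ {x y} → x < y → ¬ (y ≤ x)
  <⇒≱ (x≤y , x≉y) y≤x = x≉y (≤-antisym x≤y y≤x)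

  >⇒≉ : ∀ {x} → 0# < x → ¬ (x ≈ 0#)
  >⇒≉ 0<x x≈0 = proj₂ 0<x (sym x≈0)

  ⁻¹-inverseˡ : ∀ {x} → ¬ (x ≈ 0#) → x ⁻¹ * x ≈ 1#
  ⁻¹-inverseˡ x≉0 = trans (*-comm _ _) (⁻¹-inverseʳ x≉0)

  0<-≤-trans : ∀ {x y} → 0# < x → x ≤ y → 0# < y
  0<-≤-trans 0<x x≤y = ≤-trans (proj₁ 0<x) x≤y , λ 0≈y → <⇒≱ 0<x (≤-trans x≤y (≤-reflexive (sym 0≈y)))

  *-cancelˡ-0 : ∀ {x y} → ¬ (x ≈ 0#) → x * y ≈ 0# → y ≈ 0#
  *-cancelˡ-0 {x} {y} x≉0 xy≈0 = begin-equality
    y                ≈⟨ *-identityˡ y ⟨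
    1# * y           ≈⟨ *-congʳ (⁻¹-inverseˡ x≉0) ⟨
    x ⁻¹ * x * y     ≈⟨ *-assoc _ _ _ ⟩
    x ⁻¹ * (x * y)   ≈⟨ *-congˡ xy≈0 ⟩
    x ⁻¹ * 0#        ≈⟨ zeroʳ _ ⟩
    0#               ∎

  *-pos : ∀ {x y} → 0# < x → 0# < y → 0# < x * y
  *-pos 0<x 0<y = *-nonneg (proj₁ 0<x) (proj₁ 0<y) ,
    λ 0≈xy → >⇒≉ 0<y (*-cancelˡ-0 (>⇒≉ 0<x) (sym 0≈xy))

  +-pos-nonneg : ∀ {x y} → 0# < x → 0# ≤ y → 0# < x + y
  +-pos-nonneg {x} {y} 0<x 0≤y = +-nonneg (proj₁ 0<x) 0≤y ,
    λ 0≈x+y → <⇒≱ 0<x (begin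
      x        ≈⟨ +-identityʳ x ⟨
      x + 0#   ≤⟨ +-monoʳ-≤ x 0≤y ⟩
      x + y    ≈⟨ 0≈x+y ⟨
      0#       ∎)

  ⁻¹-pos : ∀ {x} → 0# < x → 0# < x ⁻¹
  ⁻¹-pos {x} 0<x = 0≤x⁻¹ , λ 0≈x⁻¹ → 0≉1 (begin-equality
      0#         ≈⟨ zeroʳ x ⟨
      x * 0#     ≈⟨ *-congˡ 0≈x⁻¹ ⟩
      x * x ⁻¹   ≈⟨ ⁻¹-inverseʳ x≉0 ⟩
      1#         ∎)
    where
    x≉0 = >⇒≉ 0<x
    0≤x⁻¹ : 0# ≤ x ⁻¹
    0≤x⁻¹ = begin
      0#                    ≤⟨ *-nonneg (proj₁ 0<x) (square-nonneg (x ⁻¹)) ⟩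
      x * (x ⁻¹ * x ⁻¹)     ≈⟨ *-assoc _ _ _ ⟨
      x * x ⁻¹ * x ⁻¹       ≈⟨ *-congʳ (⁻¹-inverseʳ x≉0) ⟩
      1# * x ⁻¹             ≈⟨ *-identityˡ _ ⟩
      x ⁻¹                  ∎

  ⁻¹-unique : ∀ {x y} → ¬ (x ≈ 0#) → x * y ≈ 1# → y ≈ x ⁻¹
  ⁻¹-unique {x} {y} x≉0 xy≈1 = begin-equality
    y                ≈⟨ *-identityˡ y ⟨
    1# * y           ≈⟨ *-congʳ (⁻¹-inverseˡ x≉0) ⟨
    x ⁻¹ * x * y     ≈⟨ *-assoc _ _ _ ⟩
    x ⁻¹ * (x * y)   ≈⟨ *-congˡ xy≈1 ⟩
    x ⁻¹ * 1#        ≈⟨ *-identityʳ _ ⟩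
    x ⁻¹             ∎

  ⁻¹-involutive : ∀ {x} → 0# < x → x ⁻¹ ⁻¹ ≈ x
  ⁻¹-involutive 0<x = sym (⁻¹-unique (>⇒≉ (⁻¹-pos 0<x)) (⁻¹-inverseˡ (>⇒≉ 0<x)))

  ½+½≈1 : ½ + ½ ≈ 1#
  ½+½≈1 = trans (solve 1 (λ h → h :+ h := con (+ 2) :* h) refl ½)
    (⁻¹-inverseʳ (>⇒≉ (+-pos-nonneg 0<1 0≤1)))

  0≤½ : 0# ≤ ½
  0≤½ = proj₁ (⁻¹-pos (+-pos-nonneg 0<1 0≤1))

  fromℕ-nonneg : ∀ k → 0# ≤ fromℕ k
  fromℕ-nonneg zero    = ≤-refl
  fromℕ-nonneg (suc k) = +-nonneg 0≤1 (fromℕ-nonneg k)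

  fromℕ-pos : ∀ k → 0# < fromℕ (suc k)
  fromℕ-pos k = +-pos-nonneg 0<1 (fromℕ-nonneg k)

  -- Powers, Bernoulli's inequality and the limit defining exp

  open SemiringExp semiring public using (^-homo-*; ^-assocʳ)
  open CommutativeSemiringExp (CommutativeRing.commutativeSemiring commutativeRing) public using (^-distrib-*)

  ^-nonneg : ∀ {x} → 0# ≤ x → ∀ k → 0# ≤ x ^ k
  ^-nonneg 0≤x zero    = 0≤1
  ^-nonneg 0≤x (suc k) = *-nonneg 0≤x (^-nonneg 0≤x k)

  ^-mono-≤ : ∀ {x y} → 0# ≤ x → x ≤ y → ∀ k → x ^ k ≤ y ^ k
  ^-mono-≤ 0≤x x≤y zero    = ≤-refl
  ^-mono-≤ 0≤x x≤y (suc k) =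
    *-mono-≤ (≤-trans 0≤x x≤y) (^-nonneg 0≤x k) x≤y (^-mono-≤ 0≤x x≤y k)

  ^≤1 : ∀ {x} → 0# ≤ x → x ≤ 1# → ∀ k → x ^ k ≤ 1#
  ^≤1 0≤x x≤1 zero    = ≤-refl
  ^≤1 0≤x x≤1 (suc k) = ≤-trans (*-mono-≤ 0≤1 (^-nonneg 0≤x k) x≤1 (^≤1 0≤x x≤1 k)) (≤-reflexive (*-identityˡ 1#))

  -- For negative x an odd power is a square times x, hence nonpositive, however far x lies below
  -- -1. Meant for x = 1 + ℓ/k with ℓ ≤ 0 of unknown size, whose even powers may be large.
  ^-odd≤1 : ∀ {x} → x ≤ 1# → ∀ k → x ^ suc (k ℕ.+ k) ≤ 1#
  ^-odd≤1 {x} x≤1 k with total 0# x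
  ... | inj₁ 0≤x = ^≤1 0≤x x≤1 (suc (k ℕ.+ k))
  ... | inj₂ x≤0 = begin
    x * x ^ (k ℕ.+ k)      ≈⟨ *-congˡ (^-homo-* x k k) ⟩
    x * (x ^ k * x ^ k)    ≈⟨ *-comm _ _ ⟩
    x ^ k * x ^ k * x      ≤⟨ *-monoʳ-≤ (square-nonneg (x ^ k)) x≤0 ⟩
    x ^ k * x ^ k * 0#     ≈⟨ zeroʳ _ ⟩
    0#                     ≤⟨ 0≤1 ⟩
    1#                     ∎

  -- The induction step drops k u² ≥ 0; u ≤ 1 makes the factor 1 - u, by which the induction
  -- hypothesis is multiplied, nonnegative.
  bernoulli : ∀ {u} → u ≤ 1# → ∀ k → 1# - fromℕ k * u ≤ (1# - u) ^ k
  bernoulli {u} u≤1 zero    = ≤-reflexive (solve 1 (λ u → con (+ 1) :- con (+ 0) :* u := con (+ 1)) refl u)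
  bernoulli {u} u≤1 (suc k) = begin
    1# - (1# + fromℕ k) * u                                   ≈⟨ +-identityʳ _ ⟨
    1# - (1# + fromℕ k) * u + 0#                              ≤⟨ +-monoʳ-≤ _ (*-nonneg (fromℕ-nonneg k) (square-nonneg u)) ⟩
    1# - (1# + fromℕ k) * u + fromℕ k * (u * u)
      ≈⟨ solve 2 (λ u k → con (+ 1) :- (con (+ 1) :+ k) :* u :+ k :* (u :* u)
                       := (con (+ 1) :- u) :* (con (+ 1) :- k :* u)) refl u (fromℕ k) ⟩
    (1# - u) * (1# - fromℕ k * u)                             ≤⟨ *-monoʳ-≤ (x≤y⇒0≤y-x u≤1) (bernoulli u≤1 k) ⟩
    (1# - u) * (1# - u) ^ k                                   ∎

  -- (1 - s)(1 + u)^q ≤ (1 - u²)^q ≤ 1, as s = qu.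
  [1-s][1+s/q]^q≤1 : ∀ {s u} q → 0# ≤ u → s ≤ 1# → fromℕ (suc q) * u ≈ s →
                     (1# - s) * (1# + u) ^ suc q ≤ 1#
  [1-s][1+s/q]^q≤1 {s} {u} q 0≤u s≤1 qu≈s = begin
    (1# - s) * (1# + u) ^ suc q                ≈⟨ *-congʳ (+-congˡ (-‿cong (sym qu≈s))) ⟩
    (1# - fromℕ (suc q) * u) * (1# + u) ^ suc q
      ≤⟨ *-mono-≤ (^-nonneg 0≤1-u (suc q)) (^-nonneg (+-nonneg 0≤1 0≤u) (suc q)) (bernoulli u≤1 (suc q)) ≤-refl ⟩
    (1# - u) ^ suc q * (1# + u) ^ suc q        ≈⟨ ^-distrib-* _ _ (suc q) ⟨
    ((1# - u) * (1# + u)) ^ suc q              ≤⟨ ^≤1 (*-nonneg 0≤1-u (+-nonneg 0≤1 0≤u)) [1-u][1+u]≤1 (suc q) ⟩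
    1#                                         ∎
    where
    u≤1 : u ≤ 1#
    u≤1 = begin
      u                    ≈⟨ +-identityʳ u ⟨
      u + 0#               ≤⟨ +-monoʳ-≤ u (*-nonneg (fromℕ-nonneg q) 0≤u) ⟩
      u + fromℕ q * u      ≈⟨ solve 2 (λ u q → u :+ q :* u := (con (+ 1) :+ q) :* u) refl u (fromℕ q) ⟩
      fromℕ (suc q) * u    ≈⟨ qu≈s ⟩
      s                    ≤⟨ s≤1 ⟩
      1#                   ∎
    0≤1-u = x≤y⇒0≤y-x u≤1
    [1-u][1+u]≤1 : (1# - u) * (1# + u) ≤ 1#
    [1-u][1+u]≤1 = 0≤y-x⇒x≤y (≤-trans (square-nonneg u) (≤-reflexive
      (solve 1 (λ u → u :* u := con (+ 1) :- (con (+ 1) :- u) :* (con (+ 1) :+ u)) refl u)))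

  -- If a y exceeded 1, the bound would fail on a whole tail of the sequence. Having it at
  -- arbitrarily large indices is therefore enough, and a convenient subsequence may be chosen.
  limit-≤ : ∀ {s : ℕ → ℝ} {y a} → 0# ≤ a → a ≤ 1# → s ⟶ y →
            (∀ N → ∃[ k ] (N ℕ.≤ k × a * s k ≤ 1#)) → a * y ≤ 1#
  limit-≤ {s} {y} {a} 0≤a a≤1 s⟶y frequently = decidable-stable (a * y ≤? 1#) λ ay≰1 →
    -- Since 0 ≤ a ≤ 1, multiplication by a does not enlarge distances, so the excess a y - 1 itself
    -- can be the tolerance; dividing it by a would break down at a = 0.
    let 0<δ = x≤y⇒0≤y-x (≰⇒≥ ay≰1) , λ 0≈δ → ay≰1 (0≤y-x⇒x≤y (≤-reflexive (begin-equality
                0#                ≈⟨ -0#≈0# ⟨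
                - 0#              ≈⟨ -‿cong 0≈δ ⟩
                - (a * y - 1#)    ≈⟨ solve 1 (λ z → :- (z :- con (+ 1)) := con (+ 1) :- z) refl (a * y) ⟩
                1# - a * y        ∎)))
        N , near            = s⟶y (a * y - 1#) 0<δ
        k , N≤k , a*sₖ≤1    = frequently N
    in contra 0<δ (proj₁ (near k N≤k)) a*sₖ≤1
    where
    contra : ∀ {k} → 0# < a * y - 1# → - (a * y - 1#) < s k - y → ¬ (a * s k ≤ 1#)
    contra {k} 0<δ -δ<sₖ-y a*sₖ≤1 with total 0# (y - s k)
    ... | inj₁ 0≤y-sₖ = <⇒≱ -δ<sₖ-y (begin
      s k - y            ≈⟨ solve 2 (λ s y → s :- y := :- (con (+ 1) :* (y :- s))) refl (s k) y ⟩
      - (1# * (y - s k)) ≤⟨ neg-mono (≤-trans δ≤a[y-sₖ] (*-mono-≤ 0≤1 0≤y-sₖ a≤1 ≤-refl)) ⟩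
      - (a * y - 1#)     ∎)
      where
      neg-mono : ∀ {u v} → u ≤ v → - v ≤ - u
      neg-mono {u} {v} u≤v = 0≤y-x⇒x≤y (≤-trans (x≤y⇒0≤y-x u≤v)
        (≤-reflexive (solve 2 (λ u v → v :- u := :- u :- :- v) refl u v)))
      δ≤a[y-sₖ] : a * y - 1# ≤ a * (y - s k)
      δ≤a[y-sₖ] = 0≤y-x⇒x≤y (≤-trans (x≤y⇒0≤y-x a*sₖ≤1)
        (≤-reflexive (solve 3 (λ a y s → con (+ 1) :- a :* s := a :* (y :- s) :- (a :* y :- con (+ 1))) refl a y (s k))))
    ... | inj₂ y-sₖ≤0 = <⇒≱ 0<δ (begin
      a * y - 1#                       ≈⟨ solve 3 (λ a y s → a :* y :- con (+ 1) := a :* (y :- s) :+ (a :* s :- con (+ 1))) refl a y (s k) ⟩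
      a * (y - s k) + (a * s k - 1#)   ≤⟨ +-mono-≤ (*-monoʳ-≤ 0≤a y-sₖ≤0) (+-monoˡ-≤ (- 1#) a*sₖ≤1) ⟩
      a * 0# + (1# - 1#)               ≈⟨ solve 1 (λ a → a :* con (+ 0) :+ (con (+ 1) :- con (+ 1)) := con (+ 0)) refl a ⟩
      0#                               ∎)

  -- Only the terms of (1 + ℓ/k)^k with k a multiple of K, respectively k odd, are
  -- compared with (1 - s)^K; this suffices for the limit.
  [1-s]^K*exp≤1 : ∀ {s ℓ y} K → 0# ≤ s → s ≤ 1# → ℓ ≤ fromℕ K * s → IsExp ℓ y →
                  (1# - s) ^ K * y ≤ 1#
  [1-s]^K*exp≤1 {s} {ℓ} {y} K 0≤s s≤1 ℓ≤Ks exp = limit-≤ 0≤a a≤1 exp (frequently K ℓ≤Ks)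
    where
    0≤1-s = x≤y⇒0≤y-x s≤1
    1-s≤1 : 1# - s ≤ 1#
    1-s≤1 = 0≤y-x⇒x≤y (≤-trans 0≤s (≤-reflexive (solve 1 (λ s → s := con (+ 1) :- (con (+ 1) :- s)) refl s)))
    0≤a = ^-nonneg 0≤1-s K
    a≤1 = ^≤1 0≤1-s 1-s≤1 K

    odd : ∀ K → ℓ ≤ 0# → ∀ N → ∃[ k ] (N ℕ.≤ k × (1# - s) ^ K * (1# + ℓ / fromℕ (suc k)) ^ suc k ≤ 1#)
    -- The term with index k has exponent k + 1, so the even index N + N gives an odd exponent.
    odd K ℓ≤0 N = N ℕ.+ N , ℕ.m≤m+n N N , (begin
      (1# - s) ^ K * (1# + ℓ / k) ^ suc (N ℕ.+ N)
        ≤⟨ *-monoʳ-≤ (^-nonneg 0≤1-s K) (^-odd≤1 1+ℓ/k≤1 N) ⟩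
      (1# - s) ^ K * 1#                            ≈⟨ *-identityʳ _ ⟩
      (1# - s) ^ K                                 ≤⟨ ^≤1 0≤1-s 1-s≤1 K ⟩
      1#                                           ∎)
      where
      k = fromℕ (suc (N ℕ.+ N))
      1+ℓ/k≤1 : 1# + ℓ / k ≤ 1#
      1+ℓ/k≤1 = begin
        1# + ℓ * k ⁻¹    ≈⟨ +-congˡ (*-comm _ _) ⟩
        1# + k ⁻¹ * ℓ    ≤⟨ +-monoʳ-≤ 1# (*-monoʳ-≤ (proj₁ (⁻¹-pos (fromℕ-pos (N ℕ.+ N)))) ℓ≤0) ⟩
        1# + k ⁻¹ * 0#   ≈⟨ solve 1 (λ k → con (+ 1) :+ k :* con (+ 0) := con (+ 1)) refl (k ⁻¹) ⟩
        1#               ∎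

    multiple : ∀ K → ℓ ≤ fromℕ (suc K) * s → 0# ≤ ℓ → ∀ N →
               ∃[ k ] (N ℕ.≤ k × (1# - s) ^ suc K * (1# + ℓ / fromℕ (suc k)) ^ suc k ≤ 1#)
    multiple K ℓ≤Ks 0≤ℓ N = k , N≤k , (begin
      (1# - s) ^ suc K * (1# + ℓ / fromℕ (suc k)) ^ suc k
        ≤⟨ *-monoʳ-≤ (^-nonneg 0≤1-s (suc K)) (^-mono-≤ 0≤1+ℓ/k (+-monoʳ-≤ 1# ℓ/k≤u) (suc k)) ⟩
      (1# - s) ^ suc K * (1# + u) ^ suc k           ≈⟨ *-congˡ (^-assocʳ (1# + u) (suc N) (suc K)) ⟨
      (1# - s) ^ suc K * ((1# + u) ^ suc N) ^ suc K ≈⟨ ^-distrib-* _ _ (suc K) ⟨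
      ((1# - s) * (1# + u) ^ suc N) ^ suc K
        ≤⟨ ^≤1 (*-nonneg 0≤1-s (^-nonneg (+-nonneg 0≤1 0≤u) (suc N))) ([1-s][1+s/q]^q≤1 N 0≤u s≤1 qu≈s) (suc K) ⟩
      1#                                             ∎)
      where
      -- Chosen so that `suc k` is definitionally `suc N ℕ.* suc K`: the exponent splits into
      -- `suc K` blocks of length `suc N`, one for each factor 1 - s.
      k = K ℕ.+ N ℕ.* suc K
      q = fromℕ (suc N)
      q≉0 = >⇒≉ (fromℕ-pos N)
      u = q ⁻¹ * s
      N≤k : N ℕ.≤ k
      N≤k = ℕ.≤-trans (ℕ.m≤m*n N (suc K)) (ℕ.m≤n+m _ K)
      0<k⁻¹ = ⁻¹-pos (fromℕ-pos k)
      0≤u : 0# ≤ u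
      0≤u = *-nonneg (proj₁ (⁻¹-pos (fromℕ-pos N))) 0≤s
      qu≈s : q * u ≈ s
      qu≈s = trans (sym (*-assoc _ _ _)) (trans (*-congʳ (⁻¹-inverseʳ q≉0)) (*-identityˡ s))
      Ks≈ku : fromℕ (suc K) * s ≈ fromℕ (suc k) * u
      Ks≈ku = begin-equality
        fromℕ (suc K) * s               ≈⟨ *-congˡ qu≈s ⟨
        fromℕ (suc K) * (q * u)         ≈⟨ solve 3 (λ K q u → K :* (q :* u) := q :* K :* u) refl _ _ _ ⟩
        q * fromℕ (suc K) * u           ≈⟨ *-congʳ (SemiringMult.×1-homo-* semiring (suc N) (suc K)) ⟨
        fromℕ (suc k) * u               ∎
      0≤1+ℓ/k : 0# ≤ 1# + ℓ / fromℕ (suc k)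
      0≤1+ℓ/k = +-nonneg 0≤1 (*-nonneg 0≤ℓ (proj₁ 0<k⁻¹))
      ℓ/k≤u : ℓ / fromℕ (suc k) ≤ u
      ℓ/k≤u = begin
        ℓ * fromℕ (suc k) ⁻¹                    ≈⟨ *-comm _ _ ⟩
        fromℕ (suc k) ⁻¹ * ℓ                    ≤⟨ *-monoʳ-≤ (proj₁ 0<k⁻¹) (≤-trans ℓ≤Ks (≤-reflexive Ks≈ku)) ⟩
        fromℕ (suc k) ⁻¹ * (fromℕ (suc k) * u)  ≈⟨ *-assoc _ _ _ ⟨
        fromℕ (suc k) ⁻¹ * fromℕ (suc k) * u    ≈⟨ *-congʳ (⁻¹-inverseˡ (>⇒≉ (fromℕ-pos k))) ⟩
        1# * u                                  ≈⟨ *-identityˡ u ⟩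
        u                                       ∎

    frequently : ∀ K → ℓ ≤ fromℕ K * s → ∀ N →
                 ∃[ k ] (N ℕ.≤ k × (1# - s) ^ K * (1# + ℓ / fromℕ (suc k)) ^ suc k ≤ 1#)
    -- The exponent 0 has no positive multiples, but here the hypothesis reads ℓ ≤ 0 and the odd
    -- terms serve.
    frequently zero    ℓ≤0s = odd zero (≤-trans ℓ≤0s (≤-reflexive (zeroˡ s)))
    frequently (suc K) ℓ≤Ks with total ℓ 0#
    ... | inj₁ ℓ≤0 = odd (suc K) ℓ≤0
    ... | inj₂ 0≤ℓ = multiple K ℓ≤Ks 0≤ℓ

-- Finite sums

module FiniteSums (𝓡 : CompleteOrderedField) where
  open CompleteOrderedField 𝓡
  open OrderedField 𝓡
  private module S = SemiringSum semiring

  private variable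
    k l : ℕ

  sum-cong : {f g : Fin k → ℝ} → (∀ i → f i ≈ g i) → sum f ≈ sum g
  sum-cong = S.sum-cong-≋

  sum-zero : {f : Fin k → ℝ} → (∀ i → f i ≈ 0#) → sum f ≈ 0#
  sum-zero {k = k} f≈0 = trans (sum-cong f≈0) (S.sum-replicate-zero k)

  sum-* : ∀ c (f : Fin k → ℝ) → sum (λ i → c * f i) ≈ c * sum f
  sum-* c f = sym (S.*-distribˡ-sum c f)

  -- The scalar makes one law serve both sums (c = 1) and differences (c = -1).
  sum-+* : ∀ c (f g : Fin k → ℝ) → sum (λ i → f i + c * g i) ≈ sum f + c * sum g
  sum-+* c f g = trans (S.∑-distrib-+ f (λ i → c * g i)) (+-congˡ (sum-* c g))

  sum-comm : (f : Fin k → Fin l → ℝ) → sum (λ i → sum (f i)) ≈ sum (λ j → sum (λ i → f i j))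
  sum-comm = S.∑-comm

  sum-mono-≤ : {f g : Fin k → ℝ} → (∀ i → f i ≤ g i) → sum f ≤ sum g
  sum-mono-≤ {k = zero}  f≤g = ≤-refl
  sum-mono-≤ {k = suc k} f≤g = +-mono-≤ (f≤g zero) (sum-mono-≤ (f≤g ∘ suc))

  sum-nonneg : {f : Fin k → ℝ} → (∀ i → 0# ≤ f i) → 0# ≤ sum f
  sum-nonneg {k = k} 0≤f = ≤-trans (≤-reflexive (sym (sum-zero {k = k} (λ _ → refl)))) (sum-mono-≤ 0≤f)

  term≤sum : {f : Fin k → ℝ} → (∀ i → 0# ≤ f i) → ∀ i → f i ≤ sum f
  term≤sum {f = f} 0≤f zero = begin
    f zero                      ≈⟨ +-identityʳ _ ⟨
    f zero + 0#                 ≤⟨ +-monoʳ-≤ _ (sum-nonneg (0≤f ∘ suc)) ⟩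
    f zero + sum (f ∘ suc)      ∎
  term≤sum {f = f} 0≤f (suc i) = begin
    f (suc i)                   ≤⟨ term≤sum (0≤f ∘ suc) i ⟩
    sum (f ∘ suc)               ≈⟨ +-identityˡ _ ⟨
    0# + sum (f ∘ suc)          ≤⟨ +-monoˡ-≤ _ (0≤f zero) ⟩
    f zero + sum (f ∘ suc)      ∎

  sum-single : {f : Fin k → ℝ} → ∀ i → (∀ j → j ≢ i → f j ≈ 0#) → sum f ≈ f i
  sum-single zero    f≈0 = trans (+-congˡ (sum-zero (λ j → f≈0 (suc j) (λ ())))) (+-identityʳ _)
  sum-single (suc i) f≈0 = trans
    (+-cong (f≈0 zero (λ ())) (sum-single i (λ j j≢i → f≈0 (suc j) (j≢i ∘ Fin.suc-injective))))
    (+-identityˡ _)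

  ind : Bool → ℝ
  ind a = if a then 1# else 0#

  𝟙 : Subset k → Fin k → ℝ
  𝟙 S i = ind (lookup S i)

  if-ind : ∀ a {x} → (if a then x else 0#) ≈ x * ind a
  if-ind true  = sym (*-identityʳ _)
  if-ind false = sym (zeroʳ _)

  module SumOver {n m : ℕ} (G : Graph n m) (r : Fin m → ℝ) (b : Fin n → ℝ) where
    open Network 𝓡 G r b using (sumOver)

    private variable S : Subset k

    module _ (S : Subset k) {f g : Fin k → ℝ} where
      sumOver-cong : (∀ {i} → i ∈ S → f i ≈ g i) → sumOver S f ≈ sumOver S g
      sumOver-cong f≈g = sum-cong term
        where
        term : ∀ i → (if lookup S i then f i else 0#) ≈ (if lookup S i then g i else 0#)
        term i with lookup S i in eq
        ... | true  = f≈g (lookup⇒[]= i S eq)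
        ... | false = refl

      sumOver-mono-≤ : (∀ {i} → i ∈ S → f i ≤ g i) → sumOver S f ≤ sumOver S g
      sumOver-mono-≤ f≤g = sum-mono-≤ term
        where
        term : ∀ i → (if lookup S i then f i else 0#) ≤ (if lookup S i then g i else 0#)
        term i with lookup S i in eq
        ... | true  = f≤g (lookup⇒[]= i S eq)
        ... | false = ≤-refl

    term≤sumOver : {f : Fin k → ℝ} → (∀ {i} → i ∈ S → 0# ≤ f i) → ∀ {i} → i ∈ S → f i ≤ sumOver S f
    term≤sumOver {S = S} {f = f} 0≤f {i} i∈S = begin
      f i                              ≡⟨ ≡.cong (λ a → if a then f i else 0#) ([]=⇒lookup i∈S) ⟨
      (if lookup S i then f i else 0#) ≤⟨ term≤sum term i ⟩
      sumOver S f                      ∎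
      where
      term : ∀ i → 0# ≤ (if lookup S i then f i else 0#)
      term i with lookup S i in eq
      ... | true  = 0≤f (lookup⇒[]= i S eq)
      ... | false = ≤-refl

    sumOver-𝟙 : (S : Subset k) (f : Fin k → ℝ) → sumOver S f ≈ sum (λ i → f i * 𝟙 S i)
    sumOver-𝟙 S f = sum-cong (λ i → if-ind (lookup S i))

    sumOver≤sum : (S : Subset k) {f : Fin k → ℝ} → (∀ i → 0# ≤ f i) → sumOver S f ≤ sum f
    sumOver≤sum S {f} 0≤f = sum-mono-≤ term
      where
      term : ∀ i → (if lookup S i then f i else 0#) ≤ f i
      term i with lookup S i
      ... | true  = ≤-refl
      ... | false = 0≤f i

    sum≈sumOver : (S : Subset k) {f : Fin k → ℝ} → (∀ i → i ∉ S → f i ≈ 0#) → sum f ≈ sumOver S f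
    sum≈sumOver S {f} f≈0 = sum-cong term
      where
      term : ∀ i → f i ≈ (if lookup S i then f i else 0#)
      term i with lookup S i in eq
      ... | true  = refl
      ... | false = f≈0 i (λ i∈S → contradiction (≡.trans (≡.sym ([]=⇒lookup i∈S)) eq) λ ())

    sumOver-+* : ∀ (S : Subset k) c (f g : Fin k → ℝ) →
                 sumOver S (λ i → f i + c * g i) ≈ sumOver S f + c * sumOver S g
    sumOver-+* {k = k} S c f g = trans (sum-cong term) (sum-+* {k = k} c _ _)
      where
      term : ∀ i → (if lookup S i then f i + c * g i else 0#)
                 ≈ (if lookup S i then f i else 0#) + c * (if lookup S i then g i else 0#)
      term i with lookup S i
      ... | true  = refl
      ... | false = solve 1 (λ c → con (+ 0) := con (+ 0) :+ c :* con (+ 0)) refl c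

    sumOver-* : ∀ (S : Subset k) c (f : Fin k → ℝ) → sumOver S (λ i → c * f i) ≈ c * sumOver S f
    sumOver-* {k = k} S c f = trans (sum-cong term) (sum-* {k = k} c _)
      where
      term : ∀ i → (if lookup S i then c * f i else 0#) ≈ c * (if lookup S i then f i else 0#)
      term i with lookup S i
      ... | true  = refl
      ... | false = sym (zeroʳ c)

    sumOver-sum-comm : ∀ (S : Subset k) (f : Fin k → Fin l → ℝ) →
                       sumOver S (λ i → sum (f i)) ≈ sum (λ j → sumOver S (λ i → f i j))
    sumOver-sum-comm {k = k} {l = l} S f = trans (sum-cong term) (sum-comm {k = k} {l = l} _)
      where
      term : ∀ i → (if lookup S i then sum (f i) else 0#) ≈ sum (λ j → if lookup S i then f i j else 0#)
      term i with lookup S i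
      ... | true  = refl
      ... | false = sym (sum-zero {k = l} (λ _ → refl))

    sumOver-single : {f : Fin k → ℝ} → ∀ {i} → i ∈ S → (∀ {j} → j ∈ S → j ≢ i → f j ≈ 0#) → sumOver S f ≈ f i
    sumOver-single {S = S} {f = f} {i = i} i∈S f≈0 = trans
      (sum-single i term) (reflexive (≡.cong (λ a → if a then f i else 0#) ([]=⇒lookup i∈S)))
      where
      term : ∀ j → j ≢ i → (if lookup S j then f j else 0#) ≈ 0#
      term j j≢i with lookup S j in eq
      ... | true  = f≈0 (lookup⇒[]= j S eq) j≢i
      ... | false = refl

-- Fundamental cuts of a spanning tree

x∉p-x : ∀ {n} (p : Subset n) x → x ∉ p ∖ x
x∉p-x (s ∷ p) zero    ()
x∉p-x (s ∷ p) (suc x) (thereᵥ x∈) = x∉p-x p x x∈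

module _ {n m : ℕ} {G : Graph n m} where
  open Graph G

  private variable
    u v w : Fin n
    e : Fin m
    F F′ : Subset m

  trans-walk : Walk G F u v → Walk G F v w → Walk G F u w
  trans-walk stop           w′ = w′
  trans-walk (step e p j w) w′ = step e p j (trans-walk w w′)

  edge-walk : e ∈ F → Joins e u v → Walk G F u v
  edge-walk e∈F j = step _ e∈F j stop

  sym-walk : Walk G F u v → Walk G F v u
  sym-walk stop           = stop
  sym-walk (step e p j w) = trans-walk (sym-walk w) (edge-walk p (swap j))

  ⊆-walk : F ⊆ F′ → Walk G F u v → Walk G F′ u v
  ⊆-walk s stop           = stop
  ⊆-walk s (step e p j w) = step e (s p) j (⊆-walk s w)

  vertices-⊆-walk : (s : F ⊆ F′) (w : Walk G F u v) → vertices (⊆-walk s w) ≡ vertices w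
  vertices-⊆-walk s stop           = ≡.refl
  vertices-⊆-walk s (step e p j w) = ≡.cong (_ ∷_) (vertices-⊆-walk s w)

  first∈vertices : (w : Walk G F u v) → u ∈ₗ vertices w
  first∈vertices stop           = here ≡.refl
  first∈vertices (step e p j w) = here ≡.refl

  Joins-endpoint : ∀ {a b} → Joins e u v → Joins e a b → u ≡ a ⊎ u ≡ b
  Joins-endpoint (inj₁ (≡.refl , _)) (inj₁ (≡.refl , _)) = inj₁ ≡.refl
  Joins-endpoint (inj₁ (≡.refl , _)) (inj₂ (≡.refl , _)) = inj₂ ≡.refl
  Joins-endpoint (inj₂ (_ , ≡.refl)) (inj₁ (_ , ≡.refl)) = inj₂ ≡.refl
  Joins-endpoint (inj₂ (_ , ≡.refl)) (inj₂ (_ , ≡.refl)) = inj₁ ≡.refl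

  Joins-unique : ∀ {e e′} → Joins e u v → Joins e′ u v → e ≡ e′
  Joins-unique j (inj₁ (≡.refl , ≡.refl)) = simple j
  Joins-unique j (inj₂ (≡.refl , ≡.refl)) = simple (swap j)

  Joins-distinct : Joins e u v → u ≢ v
  Joins-distinct {e} (inj₁ (≡.refl , ≡.refl)) u≡v = loopless e u≡v
  Joins-distinct {e} (inj₂ (≡.refl , ≡.refl)) u≡v = loopless e (≡.sym u≡v)

  -- An edge of w equal to e would put u among the vertices of w.
  avoiding-walk : ∀ {a b} → Joins e u v → (w : Walk G F a b) → u ∉ₗ vertices w → Walk G (F ∖ e) a b
  avoiding-walk j stop              u∉ = stop
  avoiding-walk {e} j (step e′ p j′ w) u∉ with e′ Fin.≟ e
  ... | no e′≢e = step e′ (x∈p∧x≢y⇒x∈p-y p e′≢e) j′ (avoiding-walk j w (u∉ ∘ there))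
  ... | yes ≡.refl with Joins-endpoint j j′
  ...   | inj₁ ≡.refl = contradiction (here ≡.refl) u∉
  ...   | inj₂ ≡.refl = contradiction (there (first∈vertices w)) u∉

  Walk⇒∈component : Walk G F u v → lookup (component G F u) v ≡ true
  Walk⇒∈component {F} {u} {v} w = ≡.trans (lookup∘tabulate _ v) (dec-true (walk? G F u v) w)

  ∈component⇒Walk : lookup (component G F u) v ≡ true → Walk G F u v
  ∈component⇒Walk {F} {u} {v} v∈ = from-does (walk? G F u v) (≡.trans (≡.sym (lookup∘tabulate _ v)) v∈)
    where
    from-does : ∀ {A : Set} (a? : Dec A) → does a? ≡ true → A
    from-does (yes a) _ = a

  Walk⇒same-component : ∀ u → Walk G F v w → lookup (component G F u) v ≡ lookup (component G F u) w
  Walk⇒same-component u p = ⇔→≡ {z = true} (mk⇔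
    (λ v∈ → Walk⇒∈component (trans-walk (∈component⇒Walk v∈) p))
    (λ w∈ → Walk⇒∈component (trans-walk (∈component⇒Walk w∈) (sym-walk p))))

module TreeCuts {n m : ℕ} {G : Graph n m} (tree : SpanningTree G) (root : Fin n) where
  open Graph G
  open SpanningTree tree
  open RootedTree tree root

  -- After loop erasure such a walk would close up with e to a cycle in T. The cycle has at least
  -- three edges: the walk is not empty because G is loopless, and not a single edge because G is
  -- simple and that edge would be e.
  no-bypass : ∀ {e u v} → e ∈ T → Joins e u v → ¬ Walk G (T ∖ e) u v
  no-bypass {e} {u} {v} e∈T j w with erase w
  ... | mkPath w′ distinct = acyclic (record
    { base     = v
    ; walk     = step e e∈T (swap j) (⊆-walk T∖e⊆T w′)
    ; long     = s≤s (long w′)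
    -- The cycle starts at v and enters u by e, so dropping its first vertex leaves exactly the
    -- vertices of the erased walk.
    ; distinct = ≡.subst Unique (≡.sym (vertices-⊆-walk T∖e⊆T w′)) distinct
    })
    where
    T∖e⊆T : T ∖ e ⊆ T
    T∖e⊆T = p─q⊆p T _
    long : (w : Walk G (T ∖ e) u v) → 2 ℕ.≤ length (edges (⊆-walk T∖e⊆T w))
    long stop                                   = contradiction ≡.refl (Joins-distinct {G = G} j)
    long (step e′ e′∈ j′ stop)                  = contradiction
      (≡.subst (_∈ T ∖ e) (Joins-unique {G = G} j′ j) e′∈) (x∉p-x T e)
    long (step e′ e′∈ j′ (step e″ e″∈ j″ w))    = s≤s (s≤s z≤n)

  inC : Fin m → Fin n → Bool
  inC e v = lookup (C e) v

  C-same : ∀ {e u v} → Walk G (T ∖ e) u v → inC e u ≡ inC e v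
  C-same {e} = Walk⇒same-component (tail e)

  -- Other tree edges survive the removal of e, so e is the only tree edge that crosses C(e). All
  -- tree sums below collapse because of this.
  C-same-edge : ∀ {e f u v} → f ∈ T → f ≢ e → Joins f u v → inC e u ≡ inC e v
  C-same-edge f∈T f≢e j = C-same (edge-walk (x∈p∧x≢y⇒x∈p-y f∈T f≢e) j)

  -- Two cases, because the fixed orientation of an edge may agree or disagree with its direction
  -- toward the root.
  Separates : Bool → Bool → Set
  Separates a b = (a ≡ true × b ≡ false) ⊎ (a ≡ false × b ≡ true)

  tail-endpoint : ∀ e → tail e ≡ src e ⊎ tail e ≡ tgt e
  tail-endpoint e with does (DecMembership._∈?_ Fin._≟_ e (pathEdges (src e) root))
  ... | true  = inj₁ ≡.refl
  ... | false = inj₂ ≡.refl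

  -- The tail reaches itself by the empty walk; if the other end were in the same component, a walk
  -- would bypass e.
  C-separates-ends : ∀ {e} → e ∈ T → Separates (inC e (src e)) (inC e (tgt e))
  C-separates-ends {e} e∈T with tail-endpoint e
  ... | inj₁ t≡src = inj₁ (Walk⇒∈component (≡.subst (λ t → Walk G _ t (src e)) (≡.sym t≡src) stop)
      , ¬-not (λ tgt∈C → no-bypass e∈T (inj₁ (≡.refl , ≡.refl))
                 (≡.subst (λ t → Walk G _ t (tgt e)) t≡src (∈component⇒Walk tgt∈C))))
  ... | inj₂ t≡tgt = inj₂
      ( ¬-not (λ src∈C → no-bypass e∈T (inj₂ (≡.refl , ≡.refl))
                 (≡.subst (λ t → Walk G _ t (src e)) t≡tgt (∈component⇒Walk src∈C)))
      , Walk⇒∈component (≡.subst (λ t → Walk G _ t (tgt e)) (≡.sym t≡tgt) stop))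

  C-separates : ∀ {e u v} → e ∈ T → Joins e u v → Separates (inC e u) (inC e v)
  C-separates e∈T (inj₁ (≡.refl , ≡.refl)) = C-separates-ends e∈T
  C-separates e∈T (inj₂ (≡.refl , ≡.refl)) = swap′ (C-separates-ends e∈T)
    where
    swap′ : ∀ {a b} → Separates a b → Separates b a
    swap′ (inj₁ (p , q)) = inj₂ (q , p)
    swap′ (inj₂ (p , q)) = inj₁ (q , p)

-- Electrical networks

module Electrical (𝓡 : CompleteOrderedField) {n m : ℕ} (G : Graph n m)
                  (r : Fin m → CompleteOrderedField.ℝ 𝓡)
                  (0<r : ∀ e → CompleteOrderedField._<_ 𝓡 (CompleteOrderedField.0# 𝓡) (r e))
                  (b : Fin n → CompleteOrderedField.ℝ 𝓡) where
  open CompleteOrderedField 𝓡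
  open OrderedField 𝓡
  open FiniteSums 𝓡
  open SumOver G r b
  open Network 𝓡 G r b
  open Graph G

  c : Fin m → ℝ
  c e = r e ⁻¹

  0<c : ∀ e → 0# < c e
  0<c e = ⁻¹-pos (0<r e)

  rc≈1 : ∀ e → r e * c e ≈ 1#
  rc≈1 e = ⁻¹-inverseʳ (>⇒≉ (0<r e))

  drop-across : Potential → Fin m → ℝ
  drop-across x e = x (src e) - x (tgt e)

  infix 8 ⟪_,_⟫
  -- Written as a sum over edges and not through the matrix, so that inequalities can be proved edge
  -- by edge; `‖‖²ᴸ≈⟪⟫` is the link to `L`.
  ⟪_,_⟫ : Potential → Potential → ℝ
  ⟪ x , y ⟫ = sum (λ e → c e * (drop-across x e * drop-across y e))

  infix 8 _∙_
  _∙_ : Potential → Potential → ℝ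
  x ∙ y = sum (λ i → x i * y i)

  _⊕_·_ : Potential → ℝ → Potential → Potential
  (x ⊕ t · z) v = x v + t * z v

  sum-δ : ∀ a (x : Potential) → sum (λ i → [ a ≡? i ] * x i) ≈ x a
  sum-δ a x = trans (sum-single a off) at
    where
    at : [ a ≡? a ] * x a ≈ x a
    at rewrite dec-true (a Fin.≟ a) ≡.refl = *-identityˡ _
    off : ∀ i → i ≢ a → [ a ≡? i ] * x i ≈ 0#
    off i i≢a rewrite dec-false (a Fin.≟ i) (i≢a ∘ ≡.sym) = zeroˡ _

  χ : Fin m → Fin n → ℝ
  χ e i = [ src e ≡? i ] - [ tgt e ≡? i ]

  sum-χ : ∀ e (x : Potential) → sum (λ i → χ e i * x i) ≈ drop-across x e
  sum-χ e x = begin-equality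
    sum (λ i → χ e i * x i)
      ≈⟨ sum-cong (λ i → solve 3 (λ s t x → (s :- t) :* x := s :* x :+ (:- con (+ 1)) :* (t :* x)) refl
           [ src e ≡? i ] [ tgt e ≡? i ] (x i)) ⟩
    sum (λ i → [ src e ≡? i ] * x i + - 1# * ([ tgt e ≡? i ] * x i))
      ≈⟨ sum-+* (- 1#) (λ i → [ src e ≡? i ] * x i) (λ i → [ tgt e ≡? i ] * x i) ⟩
    sum (λ i → [ src e ≡? i ] * x i) + - 1# * sum (λ i → [ tgt e ≡? i ] * x i)
      ≈⟨ +-cong (sum-δ (src e) x) (*-congˡ (sum-δ (tgt e) x)) ⟩
    x (src e) + - 1# * x (tgt e)
      ≈⟨ solve 2 (λ s t → s :+ (:- con (+ 1)) :* t := s :- t) refl (x (src e)) (x (tgt e)) ⟩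
    drop-across x e   ∎

  -- `L` is a sum of rank-one matrices, one per edge. Moving the edge sum outward, the sums over j
  -- and over i each contract an incidence vector `χ e` with x to the drop across e.
  ‖‖²ᴸ≈⟪⟫ : ∀ x → ‖ x ‖²ᴸ ≈ ⟪ x , x ⟫
  ‖‖²ᴸ≈⟪⟫ x = begin-equality
    sum (λ i → sum (λ j → x i * L i j * x j))                           ≈⟨ sum-cong row ⟩
    sum (λ i → sum (λ e → c e * drop-across x e * (χ e i * x i)))       ≈⟨ sum-comm (λ i e → c e * drop-across x e * (χ e i * x i)) ⟩
    sum (λ e → sum (λ i → c e * drop-across x e * (χ e i * x i)))
      ≈⟨ sum-cong (λ e → trans (sum-* (c e * drop-across x e) (λ i → χ e i * x i))
           (trans (*-congˡ (sum-χ e x)) (*-assoc _ _ _))) ⟩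
    ⟪ x , x ⟫                                                           ∎
    where
    row : ∀ i → sum (λ j → x i * L i j * x j) ≈ sum (λ e → c e * drop-across x e * (χ e i * x i))
    row i = begin-equality
      sum (λ j → x i * L i j * x j)
        ≈⟨ sum-cong (λ j → trans (solve 3 (λ a l b → a :* l :* b := (a :* b) :* l) refl (x i) (L i j) (x j))
             (sym (sum-* (x i * x j) (λ e → c e * (χ e i * χ e j))))) ⟩
      sum (λ j → sum (λ e → x i * x j * (c e * (χ e i * χ e j))))
        ≈⟨ sum-comm (λ j e → x i * x j * (c e * (χ e i * χ e j))) ⟩
      sum (λ e → sum (λ j → x i * x j * (c e * (χ e i * χ e j))))
        ≈⟨ sum-cong (λ e → begin-equality
             sum (λ j → x i * x j * (c e * (χ e i * χ e j)))
               ≈⟨ sum-cong (λ j → solve 5 (λ a b c s t → a :* b :* (c :* (s :* t)) := c :* (s :* a) :* (t :* b))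
                    refl (x i) (x j) (c e) (χ e i) (χ e j)) ⟩
             sum (λ j → c e * (χ e i * x i) * (χ e j * x j))
               ≈⟨ sum-* (c e * (χ e i * x i)) (λ j → χ e j * x j) ⟩
             c e * (χ e i * x i) * sum (λ j → χ e j * x j)
               ≈⟨ *-congˡ (sum-χ e x) ⟩
             c e * (χ e i * x i) * drop-across x e
               ≈⟨ solve 3 (λ c s d → c :* s :* d := c :* d :* s) refl (c e) (χ e i * x i) (drop-across x e) ⟩
             c e * drop-across x e * (χ e i * x i)   ∎) ⟩
      sum (λ e → c e * drop-across x e * (χ e i * x i))   ∎

  ⟪⟫-cong : ∀ {x x′ y y′} → (∀ v → x v ≈ x′ v) → (∀ v → y v ≈ y′ v) → ⟪ x , y ⟫ ≈ ⟪ x′ , y′ ⟫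
  ⟪⟫-cong x≈x′ y≈y′ = sum-cong {k = m} (λ e → *-congˡ (*-cong
    (+-cong (x≈x′ (src e)) (-‿cong (x≈x′ (tgt e)))) (+-cong (y≈y′ (src e)) (-‿cong (y≈y′ (tgt e))))))

  ⟪⟫-nonneg : ∀ x → 0# ≤ ⟪ x , x ⟫
  ⟪⟫-nonneg x = sum-nonneg (λ e → *-nonneg (proj₁ (0<c e)) (square-nonneg _))

  ⟪⟫-sub : ∀ z x y → ⟪ z , (λ v → x v - y v) ⟫ ≈ ⟪ z , x ⟫ - ⟪ z , y ⟫
  ⟪⟫-sub z x y = begin-equality
    ⟪ z , (λ v → x v - y v) ⟫
      ≈⟨ sum-cong (λ e → solve 6 (λ c d a b a′ b′ →
           c :* (d :* ((a :- b) :- (a′ :- b′))) := c :* (d :* (a :- a′)) :+ (:- con (+ 1)) :* (c :* (d :* (b :- b′))))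
           refl (c e) (drop-across z e) (x (src e)) (y (src e)) (x (tgt e)) (y (tgt e))) ⟩
    sum (λ e → c e * (drop-across z e * drop-across x e) + - 1# * (c e * (drop-across z e * drop-across y e)))
      ≈⟨ sum-+* (- 1#) (λ e → c e * (drop-across z e * drop-across x e)) (λ e → c e * (drop-across z e * drop-across y e)) ⟩
    ⟪ z , x ⟫ + - 1# * ⟪ z , y ⟫
      ≈⟨ solve 2 (λ s t → s :+ (:- con (+ 1)) :* t := s :- t) refl ⟪ z , x ⟫ ⟪ z , y ⟫ ⟩
    ⟪ z , x ⟫ - ⟪ z , y ⟫   ∎

  ⟪⟫-expand : ∀ x t z → ⟪ x ⊕ t · z , x ⊕ t · z ⟫
            ≈ ⟪ x , x ⟫ + (t + t) * ⟪ z , x ⟫ + t * t * ⟪ z , z ⟫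
  ⟪⟫-expand x t z = begin-equality
    ⟪ x ⊕ t · z , x ⊕ t · z ⟫
      ≈⟨ sum-cong (λ e → solve 6 (λ c t a b a′ b′ →
           c :* ((a :+ t :* a′ :- (b :+ t :* b′)) :* (a :+ t :* a′ :- (b :+ t :* b′)))
           := c :* ((a :- b) :* (a :- b)) :+ (t :+ t) :* (c :* ((a′ :- b′) :* (a :- b)))
              :+ t :* t :* (c :* ((a′ :- b′) :* (a′ :- b′))))
           refl (c e) t (x (src e)) (x (tgt e)) (z (src e)) (z (tgt e))) ⟩
    sum (λ e → xx e + (t + t) * zx e + t * t * zz e)       ≈⟨ sum-+* (t * t) (λ e → xx e + (t + t) * zx e) zz ⟩
    sum (λ e → xx e + (t + t) * zx e) + t * t * ⟪ z , z ⟫  ≈⟨ +-congʳ (sum-+* (t + t) xx zx) ⟩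
    ⟪ x , x ⟫ + (t + t) * ⟪ z , x ⟫ + t * t * ⟪ z , z ⟫    ∎
    where
    xx zx zz : Fin m → ℝ
    xx e = c e * (drop-across x e * drop-across x e)
    zx e = c e * (drop-across z e * drop-across x e)
    zz e = c e * (drop-across z e * drop-across z e)

  ∙-expand : ∀ a x t z → a ∙ (x ⊕ t · z) ≈ a ∙ x + t * a ∙ z
  ∙-expand a x t z = trans
    (sum-cong (λ i → solve 4 (λ a x t z → a :* (x :+ t :* z) := a :* x :+ t :* (a :* z)) refl (a i) (x i) t (z i)))
    (sum-+* t (λ i → a i * x i) (λ i → a i * z i))

  cut-indicator : ∀ a a′ → (ind a - ind a′) * (ind a - ind a′) ≈ (if a xor a′ then 1# else 0#)
  cut-indicator true  true  = solve 0 ((con (+ 1) :- con (+ 1)) :* (con (+ 1) :- con (+ 1)) := con (+ 0)) refl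
  cut-indicator true  false = solve 0 ((con (+ 1) :- con (+ 0)) :* (con (+ 1) :- con (+ 0)) := con (+ 1)) refl
  cut-indicator false true  = solve 0 ((con (+ 0) :- con (+ 1)) :* (con (+ 0) :- con (+ 1)) := con (+ 1)) refl
  cut-indicator false false = solve 0 ((con (+ 0) :- con (+ 0)) :* (con (+ 0) :- con (+ 0)) := con (+ 0)) refl

  lookup-δ : ∀ S e → lookup (δ S) e ≡ lookup S (src e) xor lookup S (tgt e)
  lookup-δ S e = lookup∘tabulate _ e

  conductance≈⟪⟫ : ∀ S → sumOver (δ S) c ≈ ⟪ 𝟙 S , 𝟙 S ⟫
  conductance≈⟪⟫ S = trans (sumOver-𝟙 (δ S) c) (sum-cong (λ e → *-congˡ (trans
    (reflexive (≡.cong ind (lookup-δ S e))) (sym (cut-indicator (lookup S (src e)) (lookup S (tgt e)))))))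

  cutFlow≈⟪⟫ : ∀ x S → cutFlow x S ≈ ⟪ 𝟙 S , x ⟫
  cutFlow≈⟪⟫ x S = sum-cong term
    where
    cases : ∀ a a′ d c → (if a xor a′ then (if a then d * c else - (d * c)) else 0#) ≈ c * ((ind a - ind a′) * d)
    cases true  true  = solve 2 (λ d c → con (+ 0) := c :* ((con (+ 1) :- con (+ 1)) :* d)) refl
    cases true  false = solve 2 (λ d c → d :* c := c :* ((con (+ 1) :- con (+ 0)) :* d)) refl
    cases false true  = solve 2 (λ d c → :- (d :* c) := c :* ((con (+ 0) :- con (+ 1)) :* d)) refl
    cases false false = solve 2 (λ d c → con (+ 0) := c :* ((con (+ 0) :- con (+ 0)) :* d)) refl
    term : ∀ e → (if lookup (δ S) e then (if lookup S (src e) then ohm x e else - ohm x e) else 0#)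
               ≈ c e * (drop-across (𝟙 S) e * drop-across x e)
    term e rewrite lookup-δ S e = cases (lookup S (src e)) (lookup S (tgt e)) (drop-across x e) (c e)

  -- Discrete integration by parts: the divergence is adjoint to taking drops.
  divergence-pairing : ∀ f z → divergence f ∙ z ≈ sum (λ e → f e * drop-across z e)
  divergence-pairing f z = begin-equality
    divergence f ∙ z
      ≈⟨ sum-cong (λ i → solve 3 (λ s t z → (s :- t) :* z := z :* s :+ (:- con (+ 1)) :* (z :* t)) refl
           (incident src i) (incident tgt i) (z i)) ⟩
    sum (λ i → z i * incident src i + - 1# * (z i * incident tgt i))
      ≈⟨ sum-+* (- 1#) (λ i → z i * incident src i) (λ i → z i * incident tgt i) ⟩
    sum (λ i → z i * incident src i) + - 1# * sum (λ i → z i * incident tgt i)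
      ≈⟨ +-cong (endpoint src) (*-congˡ (endpoint tgt)) ⟩
    sum (λ e → f e * z (src e)) + - 1# * sum (λ e → f e * z (tgt e))
      ≈⟨ sum-+* (- 1#) (λ e → f e * z (src e)) (λ e → f e * z (tgt e)) ⟨
    sum (λ e → f e * z (src e) + - 1# * (f e * z (tgt e)))
      ≈⟨ sum-cong (λ e → solve 3 (λ f s t → f :* s :+ (:- con (+ 1)) :* (f :* t) := f :* (s :- t)) refl
           (f e) (z (src e)) (z (tgt e))) ⟩
    sum (λ e → f e * drop-across z e)   ∎
    where
    incident : (Fin m → Fin n) → Fin n → ℝ
    incident end i = sum (λ e → [ end e ≡? i ] * f e)
    endpoint : ∀ end → sum (λ i → z i * incident end i) ≈ sum (λ e → f e * z (end e))
    endpoint end = begin-equality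
      sum (λ i → z i * incident end i)
        ≈⟨ sum-cong (λ i → sum-* (z i) (λ e → [ end e ≡? i ] * f e)) ⟨
      sum (λ i → sum (λ e → z i * ([ end e ≡? i ] * f e)))
        ≈⟨ sum-comm (λ i e → z i * ([ end e ≡? i ] * f e)) ⟩
      sum (λ e → sum (λ i → z i * ([ end e ≡? i ] * f e)))
        ≈⟨ sum-cong (λ e → trans
             (sum-cong (λ i → solve 3 (λ z d f → z :* (d :* f) := f :* (d :* z)) refl (z i) [ end e ≡? i ] (f e)))
             (trans (sum-* (f e) (λ i → [ end e ≡? i ] * z i)) (*-congˡ (sum-δ (end e) z)))) ⟩
      sum (λ e → f e * z (end e))   ∎

  flow-pairing : ∀ {f} → IsFlow f → ∀ z → sum (λ e → f e * drop-across z e) ≈ b ∙ z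
  flow-pairing {f} flow z = trans (sym (divergence-pairing f z)) (sum-cong (λ i → *-congʳ (flow i)))

  -- Otherwise the step g/(1 + ⟪z,z⟫) in direction z, where g = b∙z - ⟪z,x⟫, would increase 𝓑.
  maximizer-stationary : ∀ {x} → IsMaximizer x → ∀ z → b ∙ z ≈ ⟪ z , x ⟫
  maximizer-stationary {x} max z = decidable-stable (b ∙ z ≟ P) λ b∙z≉P →
    <⇒≱ (*-pos (g²-pos b∙z≉P) (*-pos 0<w 0<½+½w)) gain≤0
    where
    P Q w g t : ℝ
    P = ⟪ z , x ⟫
    Q = ⟪ z , z ⟫
    -- The best step would be g/Q, but Q vanishes, for instance, when z is constant.
    w = (1# + Q) ⁻¹
    g = b ∙ z - P
    t = g * w
    0<1+Q = +-pos-nonneg 0<1 (⟪⟫-nonneg z)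
    0<w = ⁻¹-pos 0<1+Q
    0<½ = ⁻¹-pos (+-pos-nonneg 0<1 0≤1)
    0<½+½w : 0# < ½ + ½ * w
    0<½+½w = +-pos-nonneg 0<½ (*-nonneg 0≤½ (proj₁ 0<w))
    g²-pos : ¬ (b ∙ z ≈ P) → 0# < g * g
    g²-pos b∙z≉P = square-nonneg g , λ 0≈g² → b∙z≉P (begin-equality
      b ∙ z   ≈⟨ solve 2 (λ a p → a := a :- p :+ p) refl (b ∙ z) P ⟩
      g + P   ≈⟨ +-congʳ (decidable-stable (g ≟ 0#) (λ g≉0 → g≉0 (*-cancelˡ-0 g≉0 (sym 0≈g²)))) ⟩
      0# + P  ≈⟨ +-identityˡ P ⟩
      P       ∎)
    -- The gain in 𝓑 is t g - t² Q / 2 with t = g w. Since Q w = 1 - w, it equals g² w (1/2 + w/2).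
    gain≤0 : g * g * (w * (½ + ½ * w)) ≤ 0#
    gain≤0 = begin
      g * g * (w * (½ + ½ * w))
        ≈⟨ solve 3 (λ g w h → g :* g :* (w :* (h :+ h :* w))
             := g :* g :* w :* (h :+ h) :- h :* (g :* g :* w) :* (con (+ 1) :- w)) refl g w ½ ⟩
      g * g * w * (½ + ½) - ½ * (g * g * w) * (1# - w)
        ≈⟨ +-congˡ (-‿cong (*-congˡ (+-congʳ (⁻¹-inverseʳ (>⇒≉ 0<1+Q))))) ⟨
      g * g * w * (½ + ½) - ½ * (g * g * w) * ((1# + Q) * w - w)
        ≈⟨ solve 7 (λ B p Q w h A X →
             let g = B :- p; t = g :* w in
             g :* g :* w :* (h :+ h) :- h :* (g :* g :* w) :* ((con (+ 1) :+ Q) :* w :- w)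
             := A :+ t :* B :* (h :+ h) :- h :* (X :+ (t :+ t) :* p :+ t :* t :* Q) :- (A :- h :* X))
             refl (b ∙ z) P Q w ½ (b ∙ x) ⟪ x , x ⟫ ⟩
      b ∙ x + t * b ∙ z * (½ + ½) - ½ * (⟪ x , x ⟫ + (t + t) * P + t * t * Q) - (b ∙ x - ½ * ⟪ x , x ⟫)
        ≈⟨ +-congʳ (+-cong (+-congˡ (trans (*-congˡ ½+½≈1) (*-identityʳ _))) refl) ⟩
      b ∙ x + t * b ∙ z - ½ * (⟪ x , x ⟫ + (t + t) * P + t * t * Q) - (b ∙ x - ½ * ⟪ x , x ⟫)
        ≈⟨ +-cong (+-cong (∙-expand b x t z) (-‿cong (*-congˡ (trans (‖‖²ᴸ≈⟪⟫ _) (⟪⟫-expand x t z)))))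
             (-‿cong (+-congˡ (-‿cong (*-congˡ (‖‖²ᴸ≈⟪⟫ x))))) ⟨
      𝓑 (x ⊕ t · z) - 𝓑 x
        ≤⟨ +-monoˡ-≤ (- 𝓑 x) (max (x ⊕ t · z)) ⟩
      𝓑 x - 𝓑 x
        ≈⟨ -‿inverseʳ _ ⟩
      0#   ∎

  𝓑-max : ∀ {x*} → IsMaximizer x* → 𝓑 x* ≈ ½ * ⟪ x* , x* ⟫
  𝓑-max {x*} max = begin-equality
      b ∙ x* - ½ * ‖ x* ‖²ᴸ                              ≈⟨ +-cong (maximizer-stationary max x*) (-‿cong (*-congˡ (‖‖²ᴸ≈⟪⟫ x*))) ⟩
      ⟪ x* , x* ⟫ - ½ * ⟪ x* , x* ⟫                      ≈⟨ +-congʳ (trans (*-congʳ ½+½≈1) (*-identityˡ _)) ⟨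
      (½ + ½) * ⟪ x* , x* ⟫ - ½ * ⟪ x* , x* ⟫            ≈⟨ solve 2 (λ h X → (h :+ h) :* X :- h :* X := h :* X) refl ½ ⟪ x* , x* ⟫ ⟩
      ½ * ⟪ x* , x* ⟫                                    ∎

  -- Completing the square on each edge: with d the drop and r c = 1, r f² is r (f - c d)² + 2 f d -
  -- c d². The cross terms sum to 2 b ∙ x because f is a flow. Both weak duality and the bound on
  -- the output energy come from this identity.
  energy-gap : ∀ {f} → IsFlow f → ∀ x →
               energy f ≈ 𝓑 x + ½ * sum (λ e → r e * ((f e - ohm x e) * (f e - ohm x e)))
  energy-gap {f} flow x = begin-equality
    ½ * sum (λ e → r e * (f e * f e))
      ≈⟨ *-congˡ (sum-cong square) ⟩
    ½ * sum (λ e → gap e + (1# + 1#) * (f e * drop-across x e) + - 1# * xx e)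
      ≈⟨ *-congˡ (trans (sum-+* (- 1#) (λ e → gap e + (1# + 1#) * (f e * drop-across x e)) xx)
           (+-congʳ (sum-+* (1# + 1#) gap (λ e → f e * drop-across x e)))) ⟩
    ½ * (sum gap + (1# + 1#) * sum (λ e → f e * drop-across x e) + - 1# * ⟪ x , x ⟫)
      ≈⟨ *-congˡ (+-congʳ (+-congˡ (*-congˡ (flow-pairing flow x)))) ⟩
    ½ * (sum gap + (1# + 1#) * b ∙ x + - 1# * ⟪ x , x ⟫)
      ≈⟨ solve 4 (λ h g B X → h :* (g :+ (con (+ 2)) :* B :+ (:- con (+ 1)) :* X) := (h :+ h) :* B :- h :* X :+ h :* g)
           refl ½ (sum gap) (b ∙ x) ⟪ x , x ⟫ ⟩
    (½ + ½) * b ∙ x - ½ * ⟪ x , x ⟫ + ½ * sum gap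
      ≈⟨ +-congʳ (+-cong (trans (*-congʳ ½+½≈1) (*-identityˡ _)) (-‿cong (*-congˡ (sym (‖‖²ᴸ≈⟪⟫ x))))) ⟩
    𝓑 x + ½ * sum gap   ∎
    where
    gap xx : Fin m → ℝ
    gap e = r e * ((f e - ohm x e) * (f e - ohm x e))
    xx e = c e * (drop-across x e * drop-across x e)
    square : ∀ e → r e * (f e * f e) ≈ gap e + (1# + 1#) * (f e * drop-across x e) + - 1# * xx e
    square e = begin-equality
      r e * (f e * f e)
        ≈⟨ solve 4 (λ r c f d → r :* (f :* f) := r :* ((f :- d :* c) :* (f :- d :* c))
             :+ (con (+ 2)) :* (f :* d) :* (r :* c) :+ (:- con (+ 1)) :* (c :* (d :* d)) :* (r :* c))
             refl (r e) (c e) (f e) (drop-across x e) ⟩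
      gap e + (1# + 1#) * (f e * drop-across x e) * (r e * c e) + - 1# * xx e * (r e * c e)
        ≈⟨ +-cong (+-congˡ (trans (*-congˡ (rc≈1 e)) (*-identityʳ _))) (trans (*-congˡ (rc≈1 e)) (*-identityʳ _)) ⟩
      gap e + (1# + 1#) * (f e * drop-across x e) + - 1# * xx e   ∎

  weak-duality : ∀ {f} → IsFlow f → ∀ x → 𝓑 x ≤ energy f
  weak-duality {f} flow x = begin
    𝓑 x                     ≈⟨ +-identityʳ _ ⟨
    𝓑 x + 0#                ≤⟨ +-monoʳ-≤ _ (*-nonneg 0≤½ (sum-nonneg (λ e → *-nonneg (proj₁ (0<r e)) (square-nonneg _)))) ⟩
    𝓑 x + ½ * sum (λ e → r e * ((f e - ohm x e) * (f e - ohm x e)))   ≈⟨ energy-gap flow x ⟨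
    energy f                ∎

  -- The minimum over t of ⟪ y - tz, y - tz ⟫ is attained at t = ⟪ z , y ⟫ R, where R = ⟪ z , z ⟫⁻¹.
  ⟪⟫-project : ∀ {y z R} → R * ⟪ z , z ⟫ ≈ 1# → let t = - (⟪ z , y ⟫ * R) in
               ⟪ y ⊕ t · z , y ⊕ t · z ⟫ ≈ ⟪ y , y ⟫ - R * (⟪ z , y ⟫ * ⟪ z , y ⟫)
  ⟪⟫-project {y} {z} {R} R⟪z,z⟫≈1 = begin-equality
    ⟪ y ⊕ - (p * R) · z , y ⊕ - (p * R) · z ⟫            ≈⟨ ⟪⟫-expand y (- (p * R)) z ⟩
    ⟪ y , y ⟫ + (- (p * R) + - (p * R)) * p + - (p * R) * - (p * R) * ⟪ z , z ⟫
      ≈⟨ solve 4 (λ Y p R q → Y :+ (:- (p :* R) :+ :- (p :* R)) :* p :+ :- (p :* R) :* :- (p :* R) :* q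
                   := Y :- con (+ 2) :* (R :* (p :* p)) :+ R :* (p :* p) :* (R :* q))
           refl ⟪ y , y ⟫ p R ⟪ z , z ⟫ ⟩
    ⟪ y , y ⟫ - (1# + 1#) * (R * (p * p)) + R * (p * p) * (R * ⟪ z , z ⟫)
      ≈⟨ +-congˡ (*-congˡ R⟪z,z⟫≈1) ⟩
    ⟪ y , y ⟫ - (1# + 1#) * (R * (p * p)) + R * (p * p) * 1#
      ≈⟨ solve 2 (λ Y a → Y :- con (+ 2) :* a :+ a :* con (+ 1) := Y :- a) refl ⟪ y , y ⟫ (R * (p * p)) ⟩
    ⟪ y , y ⟫ - R * (p * p)   ∎
    where p = ⟪ z , y ⟫

  -- What remains of y after projecting out z has nonnegative norm.
  cauchy-schwarz : ∀ {y z R} → R * ⟪ z , z ⟫ ≈ 1# → R * (⟪ z , y ⟫ * ⟪ z , y ⟫) ≤ ⟪ y , y ⟫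
  cauchy-schwarz {y} {z} {R} R⟪z,z⟫≈1 = 0≤y-x⇒x≤y (≤-trans
    (⟪⟫-nonneg (y ⊕ - (⟪ z , y ⟫ * R) · z)) (≤-reflexive (⟪⟫-project {y} {z} R⟪z,z⟫≈1)))

-- Dual KOSZ

module Analysis (𝓡 : CompleteOrderedField) {n m : ℕ} (G : Graph n m)
                (r : Fin m → CompleteOrderedField.ℝ 𝓡)
                (0<r : ∀ e → CompleteOrderedField._<_ 𝓡 (CompleteOrderedField.0# 𝓡) (r e))
                (b : Fin n → CompleteOrderedField.ℝ 𝓡)
                (tree : SpanningTree G) (root : Fin n) where
  open CompleteOrderedField 𝓡
  open OrderedField 𝓡
  open FiniteSums 𝓡
  open SumOver G r b
  open Network 𝓡 G r b
  open Graph G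
  open Electrical 𝓡 G r 0<r b
  open SpanningTree tree
  open RootedTree tree root
  open TreeCuts tree root
  open DualKOSZ tree root

  -- Indicators of the fundamental cuts

  𝟙C : Fin m → Potential
  𝟙C e = 𝟙 (C e)

  separated : ∀ {a a′} → Separates a a′ → (ind a - ind a′) * (ind a - ind a′) ≈ 1#
  separated (inj₁ (≡.refl , ≡.refl)) = cut-indicator true false
  separated (inj₂ (≡.refl , ≡.refl)) = cut-indicator false true

  unseparated : ∀ {a a′} → a ≡ a′ → ind a - ind a′ ≈ 0#
  unseparated ≡.refl = -‿inverseʳ _

  -- On tree edges this is a sign: 1 if C(e) contains `src e`, -1 if it contains `tgt e`.
  σ : Fin m → ℝ
  σ e = drop-across (𝟙C e) e

  σ²≈1 : ∀ {e} → e ∈ T → σ e * σ e ≈ 1#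
  σ²≈1 e∈T = separated (C-separates-ends e∈T)

  𝟙C-flat : ∀ {e f} → f ∈ T → f ≢ e → drop-across (𝟙C e) f ≈ 0#
  𝟙C-flat {e} f∈T f≢e = unseparated (C-same-edge {e} f∈T f≢e (inj₁ (≡.refl , ≡.refl)))

  q : Fin m → ℝ
  q e = ⟪ 𝟙C e , 𝟙C e ⟫

  -- The edge e crosses its own cut, so its conductance is one of the nonnegative terms of `q e`.
  c≤q : ∀ {e} → e ∈ T → c e ≤ q e
  c≤q {e} e∈T = begin
    c e                 ≈⟨ *-identityʳ _ ⟨
    c e * 1#            ≈⟨ *-congˡ (σ²≈1 e∈T) ⟨
    c e * (σ e * σ e)   ≤⟨ term≤sum (λ f → *-nonneg (proj₁ (0<c f)) (square-nonneg (drop-across (𝟙C e) f))) e ⟩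
    q e                 ∎

  0<q : ∀ {e} → e ∈ T → 0# < q e
  0<q {e} e∈T = 0<-≤-trans (0<c e) (c≤q e∈T)

  module _ {e : Fin m} (e∈T : e ∈ T) where
    0<conductance : 0# < sumOver (δ (C e)) c
    0<conductance = 0<-≤-trans (0<q e∈T) (≤-reflexive (sym (conductance≈⟪⟫ (C e))))

    R*q≈1 : R (C e) * q e ≈ 1#
    R*q≈1 = trans (*-congˡ (sym (conductance≈⟪⟫ (C e)))) (⁻¹-inverseˡ (>⇒≉ 0<conductance))

    0<R : 0# < R (C e)
    0<R = ⁻¹-pos 0<conductance

    r/R≈r*q : r e / R (C e) ≈ r e * q e
    r/R≈r*q = *-congˡ (trans (⁻¹-involutive 0<conductance) (conductance≈⟪⟫ (C e)))

    r/R*R≈r : r e / R (C e) * R (C e) ≈ r e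
    r/R*R≈r = trans (*-assoc _ _ _) (trans (*-congˡ (⁻¹-inverseˡ (>⇒≉ 0<R))) (*-identityʳ _))

    0≤r/R : 0# ≤ r e / R (C e)
    0≤r/R = *-nonneg (proj₁ (0<r e)) (proj₁ (⁻¹-pos 0<R))

    1≤r/R : 1# ≤ r e / R (C e)
    1≤r/R = begin
      1#              ≈⟨ rc≈1 e ⟨
      r e * c e       ≤⟨ *-monoʳ-≤ (proj₁ (0<r e)) (c≤q e∈T) ⟩
      r e * q e       ≈⟨ r/R≈r*q ⟨
      r e / R (C e)   ∎

  -- The tree edge f crosses only its own fundamental cut, so one summand survives, and in it the
  -- two signs multiply to 1 or -1 according to the direction of travel.
  telescope-edge : ∀ y {f u v} → f ∈ T → Joins f u v →
    sumOver T (λ e → (𝟙C e u - 𝟙C e v) * (σ e * drop-across y e)) ≈ y u - y v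
  telescope-edge y {f} {u} {v} f∈T j = trans
    (sumOver-single f∈T (λ {e} _ e≢f → trans
      (*-congʳ (unseparated (C-same-edge {e} f∈T (e≢f ∘ ≡.sym) j))) (zeroˡ _)))
    (at j)
    where
    at : Joins f u v → (𝟙C f u - 𝟙C f v) * (σ f * drop-across y f) ≈ y u - y v
    at (inj₁ (≡.refl , ≡.refl)) = trans (sym (*-assoc _ _ _)) (trans (*-congʳ (σ²≈1 f∈T)) (*-identityˡ _))
    at (inj₂ (≡.refl , ≡.refl)) = begin-equality
      (𝟙C f (tgt f) - 𝟙C f (src f)) * (σ f * drop-across y f)
        ≈⟨ solve 4 (λ s t y y′ → (t :- s) :* ((s :- t) :* (y :- y′)) := (s :- t) :* (s :- t) :* (y′ :- y)) refl
             (𝟙C f (src f)) (𝟙C f (tgt f)) (y (src f)) (y (tgt f)) ⟩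
      σ f * σ f * (y (tgt f) - y (src f))
        ≈⟨ trans (*-congʳ (σ²≈1 f∈T)) (*-identityˡ _) ⟩
      y (tgt f) - y (src f)   ∎

  -- Up to a constant, y is the combination of the cut indicators `𝟙C e` with coefficients
  -- `σ e * drop-across y e`: differences of both functions add up along a walk and agree on every
  -- tree edge.
  telescope : ∀ y {u v} → Walk G T u v →
    sumOver T (λ e → (𝟙C e u - 𝟙C e v) * (σ e * drop-across y e)) ≈ y u - y v
  telescope y {u} stop = begin-equality
    sumOver T (λ e → (𝟙C e u - 𝟙C e u) * (σ e * drop-across y e))
      ≈⟨ sumOver-cong T (λ {e} _ → solve 2 (λ a z → (a :- a) :* z := con (+ 0) :* z) refl (𝟙C e u) (σ e * drop-across y e)) ⟩
    sumOver T (λ e → 0# * (σ e * drop-across y e))   ≈⟨ sumOver-* T 0# (λ e → σ e * drop-across y e) ⟩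
    0# * sumOver T (λ e → σ e * drop-across y e)     ≈⟨ zeroˡ _ ⟩
    0#                                               ≈⟨ -‿inverseʳ (y u) ⟨
    y u - y u                                        ∎
  telescope y {u} {w} (step {v = v} f f∈T j p) = begin-equality
    sumOver T (λ e → (𝟙C e u - 𝟙C e w) * g e)
      ≈⟨ sumOver-cong T (λ {e} _ → solve 4 (λ a a′ a″ z → (a :- a″) :* z := (a :- a′) :* z :+ con (+ 1) :* ((a′ :- a″) :* z))
           refl (𝟙C e u) (𝟙C e v) (𝟙C e w) (g e)) ⟩
    sumOver T (λ e → (𝟙C e u - 𝟙C e v) * g e + 1# * ((𝟙C e v - 𝟙C e w) * g e))
      ≈⟨ sumOver-+* T 1# (λ e → (𝟙C e u - 𝟙C e v) * g e) (λ e → (𝟙C e v - 𝟙C e w) * g e) ⟩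
    sumOver T (λ e → (𝟙C e u - 𝟙C e v) * g e) + 1# * sumOver T (λ e → (𝟙C e v - 𝟙C e w) * g e)
      ≈⟨ +-cong (telescope-edge y f∈T j) (*-congˡ (telescope y p)) ⟩
    y u - y v + 1# * (y v - y w)
      ≈⟨ solve 3 (λ a b c → a :- b :+ con (+ 1) :* (b :- c) := a :- c) refl (y u) (y v) (y w) ⟩
    y u - y w   ∎
    where
    g : Fin m → ℝ
    g e = σ e * drop-across y e

  -- Equals 1 if C(e) separates u from v and 0 otherwise; the square removes the sign that depends
  -- on which of them lies inside.
  cut-square : Fin m → Fin n → Fin n → ℝ
  cut-square e u v = (𝟙C e u - 𝟙C e v) * (𝟙C e u - 𝟙C e v)

  -- A tree path with distinct vertices uses e exactly when C(e) separates its ends. Distinctness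
  -- matters: a walk crossing e back and forth would be longer than the right-hand side.
  pathLength≈cuts : ∀ {u v} (p : Walk G T u v) → Unique (vertices p) →
    foldr _+_ 0# (map r (edges p)) ≈ sumOver T (λ e → cut-square e u v * r e)
  pathLength≈cuts {u} stop _ = sym (begin-equality
    sumOver T (λ e → cut-square e u u * r e)
      ≈⟨ sumOver-cong T (λ {e} _ → solve 2 (λ a z → (a :- a) :* (a :- a) :* z := con (+ 0) :* z) refl (𝟙C e u) (r e)) ⟩
    sumOver T (λ e → 0# * r e)     ≈⟨ sumOver-* T 0# r ⟩
    0# * sumOver T r               ≈⟨ zeroˡ _ ⟩
    0#                             ∎)
  pathLength≈cuts {u} {w} (step {v = v} f f∈T j p) (u∉p ∷ distinct) = begin-equality
    r f + foldr _+_ 0# (map r (edges p))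
      ≈⟨ +-cong (sym edge) (trans (pathLength≈cuts p distinct) (sym (*-identityˡ _))) ⟩
    sumOver T (λ e → cut-square e u v * r e) + 1# * sumOver T (λ e → cut-square e v w * r e)
      ≈⟨ sumOver-+* T 1# (λ e → cut-square e u v * r e) (λ e → cut-square e v w * r e) ⟨
    sumOver T (λ e → cut-square e u v * r e + 1# * (cut-square e v w * r e))
      ≈⟨ sumOver-cong T (λ {e} _ → additive e) ⟩
    sumOver T (λ e → cut-square e u w * r e)   ∎
    where
    edge : sumOver T (λ e → cut-square e u v * r e) ≈ r f
    edge = trans
      (sumOver-single f∈T (λ {e} _ e≢f → trans
        (*-congʳ (trans (*-congʳ (unseparated (C-same-edge {e} f∈T (e≢f ∘ ≡.sym) j))) (zeroˡ _))) (zeroˡ _)))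
      (trans (*-congʳ (separated (C-separates f∈T j))) (*-identityˡ _))
    -- Squares are not additive along walks in general, but here one of the two vanishes: for e = f
    -- the rest of the path avoids u, hence f, and stays on one side; for any other e the first edge
    -- does not cross the cut.
    additive : ∀ e → cut-square e u v * r e + 1# * (cut-square e v w * r e) ≈ cut-square e u w * r e
    additive e with f Fin.≟ e
    ... | yes ≡.refl rewrite C-same {e} (avoiding-walk j p (All¬⇒¬Any u∉p)) =
      solve 3 (λ a a′ r → (a :- a′) :* (a :- a′) :* r :+ con (+ 1) :* ((a′ :- a′) :* (a′ :- a′) :* r) := (a :- a′) :* (a :- a′) :* r)
        refl (𝟙C e u) (𝟙C e w) (r e)
    ... | no f≢e rewrite C-same-edge {e} f∈T f≢e j =
      solve 3 (λ a a′ r → (a :- a) :* (a :- a) :* r :+ con (+ 1) :* ((a :- a′) :* (a :- a′) :* r) := (a :- a′) :* (a :- a′) :* r)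
        refl (𝟙C e v) (𝟙C e w) (r e)

  -- Double counting of pairs of a tree edge e and an edge f crossing C(e), with weight r(e)/r(f).
  -- Grouped by e they give r/R; grouped by f they give the length of the tree path between the ends
  -- of f.
  τ≈stretch : τ ≈ stretch
  τ≈stretch = begin-equality
    sumOver T (λ e → r e / R (C e))
      ≈⟨ sumOver-cong T (λ {e} e∈T → trans (r/R≈r*q e∈T) (trans
           (sym (sum-* (r e) (λ f → c f * cut-square e (src f) (tgt f))))
           (sum-cong (λ f → solve 3 (λ r c s → r :* (c :* s) := c :* (s :* r)) refl
             (r e) (c f) (cut-square e (src f) (tgt f)))))) ⟩
    sumOver T (λ e → sum (λ f → c f * (cut-square e (src f) (tgt f) * r e)))
      ≈⟨ sumOver-sum-comm T (λ e f → c f * (cut-square e (src f) (tgt f) * r e)) ⟩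
    sum (λ f → sumOver T (λ e → c f * (cut-square e (src f) (tgt f) * r e)))
      ≈⟨ sum-cong (λ f → trans (sumOver-* T (c f) (λ e → cut-square e (src f) (tgt f) * r e))
           (*-congˡ (sym (pathLength≈cuts (Path.walk (treePath (src f) (tgt f))) (Path.distinct (treePath (src f) (tgt f))))))) ⟩
    stretch   ∎

  -- By cutFlow≈⟪⟫ this is f_y(C(e)).
  p : Potential → Fin m → ℝ
  p y e = ⟪ 𝟙C e , y ⟫

  -- The tree flow σ p(y) and the electrical flow of y have the same divergence, so pairing either
  -- with y gives ⟪ y , y ⟫.
  tree-pairing : ∀ y → sumOver T (λ e → σ e * drop-across y e * p y e) ≈ ⟪ y , y ⟫
  tree-pairing y = begin-equality
    sumOver T (λ e → σ e * drop-across y e * p y e)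
      ≈⟨ sumOver-cong T (λ {e} _ → trans
           (sym (sum-* (σ e * drop-across y e) (λ f → c f * (drop-across (𝟙C e) f * drop-across y f))))
           (sum-cong (λ f → solve 4 (λ s c d y → s :* (c :* (d :* y)) := c :* y :* (d :* s)) refl
             (σ e * drop-across y e) (c f) (drop-across (𝟙C e) f) (drop-across y f)))) ⟩
    sumOver T (λ e → sum (λ f → c f * drop-across y f * (drop-across (𝟙C e) f * (σ e * drop-across y e))))
      ≈⟨ sumOver-sum-comm T (λ e f → c f * drop-across y f * (drop-across (𝟙C e) f * (σ e * drop-across y e))) ⟩
    sum (λ f → sumOver T (λ e → c f * drop-across y f * (drop-across (𝟙C e) f * (σ e * drop-across y e))))
      ≈⟨ sum-cong (λ f → trans
           (sumOver-* T (c f * drop-across y f) (λ e → drop-across (𝟙C e) f * (σ e * drop-across y e)))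
           (trans (*-congˡ (telescope y (connected (src f) (tgt f)))) (*-assoc _ _ _))) ⟩
    ⟪ y , y ⟫   ∎

  -- With d the drop of y, each tree edge satisfies 2 σ d p ≤ r p² + c d², from r (c d - σ p)² ≥ 0.
  -- By `tree-pairing` the left sides sum to 2 ⟪ y , y ⟫, and the terms c d² sum to at most ⟪ y , y
  -- ⟫, which is then subtracted.
  ⟪⟫≤tree-energy : ∀ y → ⟪ y , y ⟫ ≤ sumOver T (λ e → r e * (p y e * p y e))
  ⟪⟫≤tree-energy y = 0≤y-x⇒x≤y (begin
    0#                                     ≤⟨ x≤y⇒0≤y-x doubled ⟩
    sumOver T (λ e → r e * (p y e * p y e)) + ⟪ y , y ⟫ - (1# + 1#) * ⟪ y , y ⟫
      ≈⟨ solve 2 (λ A Y → A :+ Y :- con (+ 2) :* Y := A :- Y) refl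
           (sumOver T (λ e → r e * (p y e * p y e))) ⟪ y , y ⟫ ⟩
    sumOver T (λ e → r e * (p y e * p y e)) - ⟪ y , y ⟫   ∎)
    where
    yy : Fin m → ℝ
    yy e = c e * (drop-across y e * drop-across y e)
    term : ∀ {e} → e ∈ T → (1# + 1#) * (σ e * drop-across y e * p y e) ≤ r e * (p y e * p y e) + 1# * yy e
    term {e} e∈T = 0≤y-x⇒x≤y (begin
      0#
        ≤⟨ *-nonneg (proj₁ (0<r e)) (square-nonneg (c e * drop-across y e - σ e * p y e)) ⟩
      r e * ((c e * drop-across y e - σ e * p y e) * (c e * drop-across y e - σ e * p y e))
        ≈⟨ solve 5 (λ r c d s p → r :* ((c :* d :- s :* p) :* (c :* d :- s :* p))
              := r :* (p :* p) :* (s :* s) :+ r :* c :* (c :* (d :* d)) :- con (+ 2) :* (r :* c) :* (s :* d :* p))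
             refl (r e) (c e) (drop-across y e) (σ e) (p y e) ⟩
      r e * (p y e * p y e) * (σ e * σ e) + r e * c e * yy e - (1# + 1#) * (r e * c e) * (σ e * drop-across y e * p y e)
        ≈⟨ +-cong (+-cong (trans (*-congˡ (σ²≈1 e∈T)) (*-identityʳ _)) (*-congʳ (rc≈1 e)))
             (-‿cong (*-congʳ (trans (*-congˡ (rc≈1 e)) (*-identityʳ _)))) ⟩
      r e * (p y e * p y e) + 1# * yy e - (1# + 1#) * (σ e * drop-across y e * p y e)   ∎)
    doubled : (1# + 1#) * ⟪ y , y ⟫ ≤ sumOver T (λ e → r e * (p y e * p y e)) + ⟪ y , y ⟫
    doubled = begin
      (1# + 1#) * ⟪ y , y ⟫                                                ≈⟨ *-congˡ (tree-pairing y) ⟨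
      (1# + 1#) * sumOver T (λ e → σ e * drop-across y e * p y e)          ≈⟨ sumOver-* T (1# + 1#) (λ e → σ e * drop-across y e * p y e) ⟨
      sumOver T (λ e → (1# + 1#) * (σ e * drop-across y e * p y e))        ≤⟨ sumOver-mono-≤ T term ⟩
      sumOver T (λ e → r e * (p y e * p y e) + 1# * yy e)                  ≈⟨ sumOver-+* T 1# (λ e → r e * (p y e * p y e)) yy ⟩
      sumOver T (λ e → r e * (p y e * p y e)) + 1# * sumOver T yy
        ≤⟨ +-monoʳ-≤ _ (≤-trans (≤-reflexive (*-identityˡ _)) (sumOver≤sum T (λ e → *-nonneg (proj₁ (0<c e)) (square-nonneg _)))) ⟩
      sumOver T (λ e → r e * (p y e * p y e)) + ⟪ y , y ⟫                  ∎

  -- Error, duality gap and expectation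

  module Convergence {x* : Potential} (max : IsMaximizer x*) where

    err : Potential → Potential
    err x v = x* v - x v

    err² : Potential → ℝ
    err² x = ⟪ err x , err x ⟫

    -- Stationarity tested on the indicator of C(e) says that x* sends exactly the supply of C(e)
    -- across its cut, so the excess is the cut flow of the error.
    cut-excess : ∀ x e → supply (C e) - cutFlow x (C e) ≈ p (err x) e
    cut-excess x e = begin-equality
      supply (C e) - cutFlow x (C e)       ≈⟨ +-cong (sumOver-𝟙 (C e) b) (-‿cong (cutFlow≈⟪⟫ x (C e))) ⟩
      b ∙ 𝟙C e - p x e                     ≈⟨ +-congʳ (maximizer-stationary max (𝟙C e)) ⟩
      p x* e - p x e                       ≈⟨ ⟪⟫-sub (𝟙C e) x* x ⟨
      p (err x) e                          ∎

    err-update : ∀ x e v → err (update x e) v ≈ (err x ⊕ - (p (err x) e * R (C e)) · 𝟙C e) v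
    err-update x e v with lookup (C e) v
    ... | true  = trans
      (solve 3 (λ a x d → a :- (x :+ d) := a :- x :+ (:- d) :* con (+ 1)) refl (x* v) (x v) _)
      (+-congˡ (*-congʳ (-‿cong (*-congʳ (cut-excess x e)))))
    ... | false = solve 2 (λ z t → z := z :+ t :* con (+ 0)) refl (err x v) _

    err²-update : ∀ x {e} → e ∈ T →
      err² (update x e) ≈ err² x - R (C e) * (p (err x) e * p (err x) e)
    err²-update x {e} e∈T = trans (⟪⟫-cong (err-update x e) (err-update x e))
      (⟪⟫-project {err x} {𝟙C e} (R*q≈1 e∈T))

    energy-bound : ∀ x {f} → IsTreeDefinedFlow x f → energy f ≤ ½ * ⟪ x* , x* ⟫ + ½ * τ * err² x
    energy-bound x {f} (off-tree , flow) = begin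
      energy f                                          ≈⟨ energy-gap flow x ⟩
      𝓑 x + ½ * sum (λ e → r e * (h e * h e))
        -- This gives up the exact deficit ½ err² of 𝓑 x below 𝓑 x*; keeping it would only turn the
        -- coefficient τ into τ - 1.
        ≤⟨ +-mono-≤ (max x) (*-monoʳ-≤ 0≤½ gap≤) ⟩
      𝓑 x* + ½ * (err² x * τ)                           ≈⟨ +-cong (𝓑-max max)
                                                             (solve 3 (λ h X t → h :* (X :* t) := h :* t :* X) refl ½ (err² x) τ) ⟩
      ½ * ⟪ x* , x* ⟫ + ½ * τ * err² x                  ∎
      where
      h : Flow
      h e = f e - ohm x e
      h-off : ∀ {e} → e ∉ T → h e ≈ 0#
      h-off e∉T = trans (+-congʳ (off-tree _ e∉T)) (-‿inverseʳ _)
      -- Pair h with the indicator of C(e). Off T h vanishes, and on T only e crosses the cut, so a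
      -- single term remains; the parts f and `ohm x` of h contribute the cut flows of x* and of x.
      hσ≈p : ∀ {e} → e ∈ T → h e * σ e ≈ p (err x) e
      hσ≈p {e} e∈T = begin-equality
        h e * σ e                                             ≈⟨ sum-single e others ⟨
        sum (λ g → h g * drop-across (𝟙C e) g)
          ≈⟨ sum-cong (λ g → solve 4 (λ f d c s → (f :- d :* c) :* s := f :* s :+ (:- con (+ 1)) :* (c :* (s :* d))) refl
               (f g) (drop-across x g) (c g) (drop-across (𝟙C e) g)) ⟩
        sum (λ g → f g * drop-across (𝟙C e) g + - 1# * (c g * (drop-across (𝟙C e) g * drop-across x g)))
          ≈⟨ sum-+* (- 1#) (λ g → f g * drop-across (𝟙C e) g) (λ g → c g * (drop-across (𝟙C e) g * drop-across x g)) ⟩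
        sum (λ g → f g * drop-across (𝟙C e) g) + - 1# * p x e
          ≈⟨ +-cong (trans (flow-pairing flow (𝟙C e)) (maximizer-stationary max (𝟙C e)))
               (solve 1 (λ z → (:- con (+ 1)) :* z := :- z) refl (p x e)) ⟩
        p x* e - p x e                                        ≈⟨ ⟪⟫-sub (𝟙C e) x* x ⟨
        p (err x) e                                           ∎
        where
        others : ∀ g → g ≢ e → h g * drop-across (𝟙C e) g ≈ 0#
        others g g≢e with g ∈? T
        ... | yes g∈T = trans (*-congˡ (𝟙C-flat g∈T g≢e)) (zeroʳ _)
        ... | no  g∉T = trans (*-congʳ (h-off g∉T)) (zeroˡ _)
      term : ∀ {e} → e ∈ T → r e * (h e * h e) ≤ err² x * (r e / R (C e))
      term {e} e∈T = begin
        r e * (h e * h e)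
          -- Insert r = (r/R) R and 1 = σ²: Cauchy-Schwarz then bounds R p², and the weights r/R
          -- left over add up to τ.
          ≈⟨ *-congʳ (r/R*R≈r e∈T) ⟨
        r e / R (C e) * R (C e) * (h e * h e)
          ≈⟨ trans (*-congˡ (σ²≈1 e∈T)) (*-identityʳ _) ⟨
        r e / R (C e) * R (C e) * (h e * h e) * (σ e * σ e)
          ≈⟨ solve 4 (λ w R h s → w :* R :* (h :* h) :* (s :* s) := w :* (R :* ((h :* s) :* (h :* s)))) refl
               (r e / R (C e)) (R (C e)) (h e) (σ e) ⟩
        r e / R (C e) * (R (C e) * ((h e * σ e) * (h e * σ e)))
          ≈⟨ *-congˡ (*-congˡ (*-cong (hσ≈p e∈T) (hσ≈p e∈T))) ⟩
        r e / R (C e) * (R (C e) * (p (err x) e * p (err x) e))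
          ≤⟨ *-monoʳ-≤ (0≤r/R e∈T) (cauchy-schwarz {err x} {𝟙C e} (R*q≈1 e∈T)) ⟩
        r e / R (C e) * err² x
          ≈⟨ *-comm _ _ ⟩
        err² x * (r e / R (C e))   ∎
      gap≤ : sum (λ e → r e * (h e * h e)) ≤ err² x * τ
      gap≤ = begin
        sum (λ e → r e * (h e * h e))
          ≈⟨ sum≈sumOver T (λ e e∉T → trans (*-congˡ (trans (*-congʳ (h-off e∉T)) (zeroˡ _))) (zeroʳ _)) ⟩
        sumOver T (λ e → r e * (h e * h e))           ≤⟨ sumOver-mono-≤ T term ⟩
        sumOver T (λ e → err² x * (r e / R (C e)))    ≈⟨ sumOver-* T (err² x) (λ e → r e / R (C e)) ⟩
        err² x * τ                                    ∎

    module _ (0<τ : 0# < τ) (τ⁻¹≤1 : τ ⁻¹ ≤ 1#) where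
      private
        s = τ ⁻¹
        0≤s = proj₁ (⁻¹-pos 0<τ)
        sτ≈1 = ⁻¹-inverseˡ (>⇒≉ 0<τ)

      0≤probability : ∀ {e} → e ∈ T → 0# ≤ probability e
      0≤probability e∈T = *-nonneg 0≤s (0≤r/R e∈T)

      Σprobability≈1 : sumOver T probability ≈ 1#
      Σprobability≈1 = trans (sumOver-* T s (λ e → r e / R (C e))) sτ≈1

      -- The sampling weight r/R cancels the R in the decrease of each update, so the expected
      -- decrease is s times a tree energy, to which `⟪⟫≤tree-energy` applies.
      one-step : ∀ x → sumOver T (λ e → probability e * err² (update x e)) ≤ (1# - s) * err² x
      one-step x = begin
        sumOver T (λ e → probability e * err² (update x e))    ≈⟨ sumOver-cong T term ⟩
        sumOver T (λ e → err² x * probability e + - s * (r e * (p (err x) e * p (err x) e)))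
          ≈⟨ sumOver-+* T (- s) (λ e → err² x * probability e) (λ e → r e * (p (err x) e * p (err x) e)) ⟩
        sumOver T (λ e → err² x * probability e) + - s * A
          ≈⟨ +-congʳ (trans (sumOver-* T (err² x) probability) (*-congˡ Σprobability≈1)) ⟩
        err² x * 1# + - s * A
          ≈⟨ solve 3 (λ X s A → X :* con (+ 1) :+ (:- s) :* A := X :- s :* A) refl (err² x) s A ⟩
        err² x - s * A
          ≤⟨ 0≤y-x⇒x≤y (≤-trans (*-nonneg 0≤s (x≤y⇒0≤y-x (⟪⟫≤tree-energy (err x))))
               (≤-reflexive (solve 3 (λ X s A → s :* (A :- X) := (con (+ 1) :- s) :* X :- (X :- s :* A)) refl (err² x) s A))) ⟩
        (1# - s) * err² x   ∎
        where
        A = sumOver T (λ e → r e * (p (err x) e * p (err x) e))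
        term : ∀ {e} → e ∈ T → probability e * err² (update x e)
             ≈ err² x * probability e + - s * (r e * (p (err x) e * p (err x) e))
        term {e} e∈T = begin-equality
          probability e * err² (update x e)                                ≈⟨ *-congˡ (err²-update x e∈T) ⟩
          s * w * (err² x - R (C e) * pp)
            ≈⟨ solve 5 (λ s w X R z → s :* w :* (X :- R :* z) := X :* (s :* w) :+ (:- s) :* (w :* R :* z)) refl
                 s w (err² x) (R (C e)) pp ⟩
          err² x * probability e + - s * (w * R (C e) * pp)                ≈⟨ +-congˡ (*-congˡ (*-congʳ (r/R*R≈r e∈T))) ⟩
          err² x * probability e + - s * (r e * pp)                        ∎
          where
          w = r e / R (C e)
          pp = p (err x) e * p (err x) e

      𝔼-mono-≤ : ∀ K {φ ψ : Vec (Fin m) K → ℝ} → (∀ ω → φ ω ≤ ψ ω) → 𝔼 K φ ≤ 𝔼 K ψ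
      𝔼-mono-≤ zero    φ≤ψ = φ≤ψ []
      𝔼-mono-≤ (suc K) φ≤ψ = sumOver-mono-≤ T (λ {e} e∈T →
        *-monoʳ-≤ (0≤probability e∈T) (𝔼-mono-≤ K (λ ω → φ≤ψ (e ∷ ω))))

      -- The constant term is needed for `energy-bound`; it passes through because the probabilities
      -- on T add up to 1.
      𝔼-affine : ∀ K a t (φ : Vec (Fin m) K → ℝ) → 𝔼 K (λ ω → a + t * φ ω) ≈ a + t * 𝔼 K φ
      𝔼-affine zero    a t φ = refl
      𝔼-affine (suc K) a t φ = begin-equality
        sumOver T (λ e → probability e * 𝔼 K (λ ω → a + t * φ (e ∷ ω)))
          ≈⟨ sumOver-cong T (λ {e} _ → trans (*-congˡ (𝔼-affine K a t (λ ω → φ (e ∷ ω))))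
               (solve 4 (λ p a t E → p :* (a :+ t :* E) := a :* p :+ t :* (p :* E)) refl
                 (probability e) a t (𝔼 K (λ ω → φ (e ∷ ω))))) ⟩
        sumOver T (λ e → a * probability e + t * (probability e * 𝔼 K (λ ω → φ (e ∷ ω))))
          ≈⟨ sumOver-+* T t (λ e → a * probability e) (λ e → probability e * 𝔼 K (λ ω → φ (e ∷ ω))) ⟩
        sumOver T (λ e → a * probability e) + t * 𝔼 (suc K) φ
          ≈⟨ +-congʳ (trans (sumOver-* T a probability) (trans (*-congˡ Σprobability≈1) (*-identityʳ a))) ⟩
        a + t * 𝔼 (suc K) φ   ∎

      -- Stated for every start x, since `𝔼` and `run` both peel off the first sample and the
      -- induction continues from `update x e`.
      𝔼-err² : ∀ K x → 𝔼 K (λ ω → err² (run x ω)) ≤ (1# - s) ^ K * err² x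
      𝔼-err² zero    x = ≤-reflexive (sym (*-identityˡ _))
      𝔼-err² (suc K) x = begin
        sumOver T (λ e → probability e * 𝔼 K (λ ω → err² (run (update x e) ω)))
          ≤⟨ sumOver-mono-≤ T (λ {e} e∈T → *-monoʳ-≤ (0≤probability e∈T) (𝔼-err² K (update x e))) ⟩
        sumOver T (λ e → probability e * ((1# - s) ^ K * err² (update x e)))
          ≈⟨ sumOver-cong T (λ {e} _ → solve 3 (λ p a X → p :* (a :* X) := a :* (p :* X)) refl
               (probability e) ((1# - s) ^ K) (err² (update x e))) ⟩
        sumOver T (λ e → (1# - s) ^ K * (probability e * err² (update x e)))
          ≈⟨ sumOver-* T ((1# - s) ^ K) (λ e → probability e * err² (update x e)) ⟩
        (1# - s) ^ K * sumOver T (λ e → probability e * err² (update x e))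
          ≤⟨ *-monoʳ-≤ (^-nonneg (x≤y⇒0≤y-x τ⁻¹≤1) K) (one-step x) ⟩
        (1# - s) ^ K * ((1# - s) * err² x)
          ≈⟨ solve 3 (λ a z X → a :* (z :* X) := z :* a :* X) refl ((1# - s) ^ K) (1# - s) (err² x) ⟩
        (1# - s) ^ suc K * err² x   ∎

    module _ (1≤τ : 1# ≤ τ) where
      private
        0<τ : 0# < τ
        0<τ = 0<-≤-trans 0<1 1≤τ
        s = τ ⁻¹
        0≤s = proj₁ (⁻¹-pos 0<τ)
        s≤1 : s ≤ 1#
        s≤1 = begin
          s         ≈⟨ *-identityʳ s ⟨
          s * 1#    ≤⟨ *-monoʳ-≤ 0≤s 1≤τ ⟩
          s * τ     ≈⟨ ⁻¹-inverseˡ (>⇒≉ 0<τ) ⟩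
          1#        ∎

      module _ {ε : ℝ} (0<ε : 0# < ε) {ℓ : ℝ} (ln : IsLn (τ / ε) ℓ) (K : ℕ) (τℓ≤K : τ * ℓ ≤ fromℕ K) where

        -- The hypothesis on K says ℓ ≤ K s, and exp ℓ is τ/ε; so (1 - s)^K τ/ε ≤ 1, to be
        -- multiplied by ε/τ.
        [1-s]^K≤ε/τ : (1# - s) ^ K ≤ ε / τ
        [1-s]^K≤ε/τ = begin
          a                               ≈⟨ *-identityʳ a ⟨
          a * 1#                          ≈⟨ *-congˡ (trans (*-cong (⁻¹-inverseʳ (>⇒≉ 0<τ)) (⁻¹-inverseˡ (>⇒≉ 0<ε))) (*-identityˡ 1#)) ⟨
          a * (τ * s * (ε ⁻¹ * ε))        ≈⟨ solve 5 (λ a t s e′ e → a :* (t :* s :* (e′ :* e)) := e :* s :* (a :* (t :* e′))) refl a τ s (ε ⁻¹) ε ⟩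
          ε / τ * (a * (τ / ε))           ≤⟨ *-monoʳ-≤ (*-nonneg (proj₁ 0<ε) 0≤s) ([1-s]^K*exp≤1 K 0≤s s≤1 ℓ≤Ks ln) ⟩
          ε / τ * 1#                      ≈⟨ *-identityʳ _ ⟩
          ε / τ                           ∎
          where
          a = (1# - s) ^ K
          ℓ≤Ks : ℓ ≤ fromℕ K * s
          ℓ≤Ks = begin
            ℓ              ≈⟨ *-identityˡ ℓ ⟨
            1# * ℓ         ≈⟨ *-congʳ (⁻¹-inverseˡ (>⇒≉ 0<τ)) ⟨
            s * τ * ℓ      ≈⟨ *-assoc _ _ _ ⟩
            s * (τ * ℓ)    ≤⟨ *-monoʳ-≤ 0≤s τℓ≤K ⟩
            s * fromℕ K    ≈⟨ *-comm _ _ ⟩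
            fromℕ K * s    ∎

        𝔼-err²≤ : 𝔼 K (λ ω → err² (xᴷ ω)) ≤ ε / τ * ⟪ x* , x* ⟫
        𝔼-err²≤ = begin
          𝔼 K (λ ω → err² (xᴷ ω))             ≤⟨ 𝔼-err² 0<τ s≤1 K (λ _ → 0#) ⟩
          (1# - s) ^ K * err² (λ _ → 0#)      ≈⟨ *-congˡ (⟪⟫-cong x*-0≈x* x*-0≈x*) ⟩
          (1# - s) ^ K * ⟪ x* , x* ⟫          ≈⟨ *-comm _ _ ⟩
          ⟪ x* , x* ⟫ * (1# - s) ^ K          ≤⟨ *-monoʳ-≤ (⟪⟫-nonneg x*) [1-s]^K≤ε/τ ⟩
          ⟪ x* , x* ⟫ * (ε / τ)               ≈⟨ *-comm _ _ ⟩
          ε / τ * ⟪ x* , x* ⟫                 ∎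
          where
          x*-0≈x* : ∀ v → x* v - 0# ≈ x* v
          x*-0≈x* v = solve 1 (λ a → a :- con (+ 0) := a) refl (x* v)

        𝔼-distance : 𝔼 K (λ ω → ‖ err (xᴷ ω) ‖²ᴸ) ≤ ε / τ * ‖ x* ‖²ᴸ
        𝔼-distance = begin
          𝔼 K (λ ω → ‖ err (xᴷ ω) ‖²ᴸ)   ≤⟨ 𝔼-mono-≤ 0<τ s≤1 K (λ ω → ≤-reflexive (‖‖²ᴸ≈⟪⟫ (err (xᴷ ω)))) ⟩
          𝔼 K (λ ω → err² (xᴷ ω))        ≤⟨ 𝔼-err²≤ ⟩
          ε / τ * ⟪ x* , x* ⟫            ≈⟨ *-congˡ (‖‖²ᴸ≈⟪⟫ x*) ⟨
          ε / τ * ‖ x* ‖²ᴸ               ∎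

        -- The coefficient τ/2 of `energy-bound` meets the factor ε/τ of `𝔼-err²≤` and leaves ε/2.
        -- Both terms are then multiples of ½ ⟪ x* , x* ⟫, the optimal dual value, which weak
        -- duality bounds by the energy of f*.
        𝔼-energy : ∀ f* → IsFlow f* →
                   (fᴷ : Vec (Fin m) K → Flow) → (∀ ω → IsTreeDefinedFlow (xᴷ ω) (fᴷ ω)) →
                   𝔼 K (λ ω → energy (fᴷ ω)) ≤ (1# + ε) * energy f*
        𝔼-energy f* flow fᴷ tree-defined = begin
          𝔼 K (λ ω → energy (fᴷ ω))                     ≤⟨ 𝔼-mono-≤ 0<τ s≤1 K (λ ω → energy-bound (xᴷ ω) (tree-defined ω)) ⟩
          𝔼 K (λ ω → ½ * X + ½ * τ * err² (xᴷ ω))       ≈⟨ 𝔼-affine 0<τ s≤1 K (½ * X) (½ * τ) (λ ω → err² (xᴷ ω)) ⟩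
          ½ * X + ½ * τ * 𝔼 K (λ ω → err² (xᴷ ω))       ≤⟨ +-monoʳ-≤ _ (*-monoʳ-≤ (*-nonneg 0≤½ (proj₁ 0<τ)) 𝔼-err²≤) ⟩
          ½ * X + ½ * τ * (ε / τ * X)
            ≈⟨ solve 5 (λ h X t e s → h :* X :+ h :* t :* (e :* s :* X) := h :* X :+ e :* (h :* X) :* (t :* s)) refl ½ X τ ε s ⟩
          ½ * X + ε * (½ * X) * (τ * s)                 ≈⟨ +-congˡ (trans (*-congˡ (⁻¹-inverseʳ (>⇒≉ 0<τ))) (*-identityʳ _)) ⟩
          ½ * X + ε * (½ * X)                           ≈⟨ solve 2 (λ e Z → Z :+ e :* Z := (con (+ 1) :+ e) :* Z) refl ε (½ * X) ⟩
          (1# + ε) * (½ * X)                            ≈⟨ *-congˡ (𝓑-max max) ⟨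
          (1# + ε) * 𝓑 x*                               ≤⟨ *-monoʳ-≤ (+-nonneg 0≤1 (proj₁ 0<ε)) (weak-duality flow x*) ⟩
          (1# + ε) * energy f*                          ∎
          where X = ⟪ x* , x* ⟫

  ∈T⇒1≤τ : ∀ {e} → e ∈ T → 1# ≤ τ
  ∈T⇒1≤τ e∈T = ≤-trans (1≤r/R e∈T) (term≤sumOver 0≤r/R e∈T)

  nontrivial-walk : ∀ {u v} → u ≢ v → Walk G T u v → ∃[ e ] e ∈ T
  nontrivial-walk u≢v stop              = contradiction ≡.refl u≢v
  nontrivial-walk u≢v (step e e∈T j p)  = e , e∈T

  -- The ends of an edge are distinct and T connects them, so T has an edge.
  edge⇒1≤τ : Fin m → 1# ≤ τ
  edge⇒1≤τ e = ∈T⇒1≤τ (proj₂ (nontrivial-walk (loopless e) (connected (src e) (tgt e))))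

theorem1 : (𝓡 : CompleteOrderedField) → let open CompleteOrderedField 𝓡 in
    ∀ {n m : ℕ} (G : Graph n m) → Connected G ⊤ →
    (r : Fin m → ℝ) → (∀ e → 0# < r e) →
    (b : Fin n → ℝ) → sum b ≈ 0# →
    (tree : SpanningTree G) (root : Fin n) →
    let open Network 𝓡 G r b
        open DualKOSZ tree root in
    (τ ≈ stretch) ×
    ((ε : ℝ) → 0# < ε →
     (ℓ : ℝ) → IsLn (τ / ε) ℓ →
     (K : ℕ) → τ * ℓ ≤ fromℕ K →
     (x* : Potential) → IsMaximizer x* →
     (f* : Flow) → IsMinimumEnergyFlow f* →
     (fᴷ : Vec (Fin m) K → Flow) → (∀ ω → IsTreeDefinedFlow (xᴷ ω) (fᴷ ω)) →
     (𝔼 K (λ ω → ‖ (λ v → x* v - xᴷ ω v) ‖²ᴸ) ≤ (ε / τ) * ‖ x* ‖²ᴸ) ×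
     (𝔼 K (λ ω → energy (fᴷ ω)) ≤ (1# + ε) * energy f*))
theorem1 𝓡 {m = suc m} G _ r 0<r b _ tree root = τ≈stretch ,
  λ ε 0<ε ℓ ln K τℓ≤K x* max f* (flow , _) fᴷ tree-defined →
    let open Convergence max in
    𝔼-distance (edge⇒1≤τ zero) 0<ε ln K τℓ≤K ,
    𝔼-energy (edge⇒1≤τ zero) 0<ε ln K τℓ≤K f* flow fᴷ tree-defined
  where open Analysis 𝓡 G r 0<r b tree root
-- Without edges τ is an empty sum, its inverse is unspecified and the probabilities do not add up
-- to 1. But all norms and energies are then empty sums too, so both sides of each inequality
-- vanish.
theorem1 𝓡 {m = zero} G _ r 0<r b _ tree root = τ≈stretch ,
  λ ε 0<ε ℓ ln K τℓ≤K x* max f* _ fᴷ _ →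
    both-zero (𝔼-zero K (λ ω → ‖‖²ᴸ≈⟪⟫ _)) (trans (*-congˡ (‖‖²ᴸ≈⟪⟫ x*)) (zeroʳ _)) ,
    both-zero (𝔼-zero K (λ ω → zeroʳ ½)) (trans (*-congˡ (zeroʳ ½)) (zeroʳ _))
  where
  open CompleteOrderedField 𝓡
  open OrderedField 𝓡
  open Network 𝓡 G r b
  open DualKOSZ tree root
  open Analysis 𝓡 G r 0<r b tree root
  open Electrical 𝓡 G r 0<r b
  both-zero : ∀ {x y} → x ≈ 0# → y ≈ 0# → x ≤ y
  both-zero x≈0 y≈0 = ≤-reflexive (trans x≈0 (sym y≈0))
  𝔼-zero : ∀ K {φ : Vec (Fin 0) K → ℝ} → (∀ ω → φ ω ≈ 0#) → 𝔼 K φ ≈ 0#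
  𝔼-zero zero    φ≈0 = φ≈0 []
  𝔼-zero (suc K) φ≈0 with SpanningTree.T tree
  ... | [] = refl
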